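{- Let $q>2$ be a prime power and let $n\ge0$ be an integer. Then the multizeta value $\zeta_A(1,q^2-1,(q-1)q^2,(q-1)q^3,\dots,(q-1)q^{n+1})$ (of depth $n+2$ and weight $q^{n+2}$) is zeta-like; more precisely, $$\zeta_A(1,q^2-1,(q-1)q^2,\dots,(q-1)q^{n+1})=\frac{(-1)^{n+1}([n+2]-1)}{[1]\,[n+2]}\cdot\frac{1}{\prod_{k=1}^{n}[k]^{q^{n+2-k}}}\,\zeta_A(q^{n+2}).$$
   Context: $A=\mathbb{F}_q[\theta]$, $A_+$ the monic polynomials, $K=\mathbb{F}_q(\theta)$, $[k]=\theta^{q^k}-\theta$. For $s\in\mathbb{Z}$, $d\ge0$ let $S_d(s)=\sum_{a\in A_+,\deg a=d}a^{ -s}$. For positive integers $s_1,\dots,s_r$, the Thakur multizeta value is $\zeta_A(s_1,\dots,s_r)=\sum_{d_1>\cdots>d_r\ge0}S_{d_1}(s_1)\cdots S_{d_r}(s_r)\in\mathbb{F}_q((1/\theta))$, and $\zeta_A(k)=\sum_{a\in A_+}a^{ -k}$. A multizeta value of weight $w=\sum s_i$ is called zeta-like if $\zeta_A(s_1,\dots,s_r)/\zeta_A(w)\in K$. For $n=0$ the tuple is $(1,q^2-1)$ and the empty product is $1$. -}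

module Defs where

open import Level using (0ℓ)
open import Data.Nat as ℕ using (ℕ; zero; suc; _∸_; _^_)
open import Data.Integer as ℤ using (ℤ; +_)
open import Data.List using (_++_; List; []; _∷_; [_]; length; map; foldr; concatMap)
open import Data.List.Membership.Propositional using (_∈_)
open import Data.List.Relation.Unary.Unique.Propositional using (Unique)
open import Data.Vec using (Vec; []; _∷_)
open import Relation.Binary.PropositionalEquality using (_≡_; _≢_)
open import Relation.Nullary using (yes; no)
import Algebra.Structures as AS

record FiniteField : Set₁ where
  infixl 6 _+_
  infixl 7 _*_
  field
    F        : Set
    _+_ _*_  : F → F → F
    -_       : F → F
    0# 1#    : F
    _⁻¹      : F → F
    isCommutativeRing : AS.IsCommutativeRing {A = F} _≡_ _+_ _*_ -_ 0# 1#
    0≢1      : 0# ≢ 1#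
    inverse  : ∀ x → x ≢ 0# → x * (x ⁻¹) ≡ 1#
    elems    : List F
    complete : ∀ x → x ∈ elems
    unique   : Unique elems

  q : ℕ
  q = length elems

module Thakur (𝔽 : FiniteField) where
  open FiniteField 𝔽

  sumF : ℕ → (ℕ → F) → F
  sumF zero    f = 0#
  sumF (suc n) f = sumF n f + f n

  -- the Laurent series  Σ_{k ≥ 0} co k · θ^(top - k)
  record Laurent : Set where
    constructor laurent
    field
      top : ℤ
      co  : ℕ → F
  open Laurent public

  coeff : Laurent → ℤ → F
  coeff L i with i ℤ.≤? top L
  ... | yes _ = co L ℤ.∣ top L ℤ.- i ∣
  ... | no  _ = 0#

  infix 4 _≋_
  _≋_ : Laurent → Laurent → Set
  L ≋ M = ∀ i → coeff L i ≡ coeff M i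

  zeroL : Laurent
  zeroL = laurent (+ 0) (λ _ → 0#)

  const : F → Laurent
  const c = laurent (+ 0) (λ { zero → c ; (suc _) → 0# })

  oneL : Laurent
  oneL = const 1#

  θ^ : ℕ → Laurent
  θ^ t = laurent (+ t) (λ { zero → 1# ; (suc _) → 0# })

  addL : Laurent → Laurent → Laurent
  addL L M = laurent t (λ k → coeff L (t ℤ.- + k) + coeff M (t ℤ.- + k))
    where t = top L ℤ.⊔ top M

  negL : Laurent → Laurent
  negL L = laurent (top L) (λ k → - co L k)

  subL : Laurent → Laurent → Laurent
  subL L M = addL L (negL M)

  mulL : Laurent → Laurent → Laurent
  mulL L M = laurent (top L ℤ.+ top M)
                     (λ k → sumF (suc k) (λ j → co L j * co M (k ∸ j)))

  powL : Laurent → ℕ → Laurent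
  powL L zero    = oneL
  powL L (suc s) = mulL L (powL L s)

  sumL : List Laurent → Laurent
  sumL = foldr addL zeroL

  sumRange : ℕ → (ℕ → Laurent) → Laurent
  sumRange zero    f = zeroL
  sumRange (suc n) f = addL (sumRange n f) (f n)

  prodRange : ℕ → (ℕ → Laurent) → Laurent
  prodRange zero    f = oneL
  prodRange (suc n) f = mulL (prodRange n f) (f n)

  nth : List F → ℕ → F
  nth []       _       = 0#
  nth (x ∷ xs) zero    = x
  nth (x ∷ xs) (suc i) = nth xs i

  -- Inverse of a Laurent series L with leading coefficient co L 0 = 1
  -- (a "monic" series): u_0 = 1, u_k = - Σ_{i=1}^{k} co L i · u_{k-i}.
  -- invPrefix L k = [u_k , u_{k-1} , … , u_0].
  invPrefix : Laurent → ℕ → List F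
  invPrefix L zero    = 1# ∷ []
  invPrefix L (suc k) =
    (- sumF (suc k) (λ i → co L (suc i) * nth prev i)) ∷ prev
    where prev = invPrefix L k

  invMonic : Laurent → Laurent
  invMonic L = laurent (ℤ.- top L) (λ k → nth (invPrefix L k) 0)

  -- Monic polynomials of degree d: θ^d + Σ_{j<d} v_j θ^j, v : Vec F d.
  vget : ∀ {d} → Vec F d → ℕ → F
  vget []       _       = 0#
  vget (x ∷ v) zero    = x
  vget (x ∷ v) (suc j) = vget v j

  monicPoly : ∀ d → Vec F d → Laurent
  monicPoly d v = laurent (+ d) c
    where
      c : ℕ → F
      c zero = 1#
      c (suc i) with suc i ℕ.≤? d
      ... | yes _ = vget v (d ∸ suc i)
      ... | no  _ = 0#

  allVecs : ∀ d → List (Vec F d)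
  allVecs zero    = [] ∷ []
  allVecs (suc d) = concatMap (λ x → map (x ∷_) (allVecs d)) elems

  S : ℕ → ℕ → Laurent
  S d s = sumL (map (λ v → powL (invMonic (monicPoly d v)) s) (allVecs d))

  Z : List ℕ → ℕ → Laurent
  Z []       D = oneL
  Z (s ∷ ss) D = sumRange D (λ d → mulL (S d s) (Z ss d))

  -- Thakur multizeta value ζ_A(s_1,…,s_r) (all s_i ≥ 1), as the limit
  -- in F_q((1/θ)) of the partial sums: the coefficient of θ^{-m} is that of
  -- the partial sum over d_1 ≤ m, since the remaining terms have valuation
  -- ≥ (m+1)·s_1 ≥ m+1 in 1/θ.  All terms lie in (1/θ)-adic integers, so top = 0.
  ζ : List ℕ → Laurent
  ζ ss = laurent (+ 0) (λ m → coeff (Z ss (suc m)) (ℤ.- (+ m)))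

  br : ℕ → Laurent
  br k = subL (θ^ (q ^ k)) (θ^ 1)

  tuple : ℕ → List ℕ
  tuple n = 1 ∷ (q ^ 2 ∸ 1) ∷ map (λ j → (q ∸ 1) ℕ.* q ^ (2 ℕ.+ j)) (upto n)
    where
      upto : ℕ → List ℕ
      upto zero    = []
      upto (suc m) = upto m ++ [ m ]

  ratio : ℕ → Laurent
  ratio n =
    mulL (powL (negL oneL) (suc n))
    (mulL (subL (br (2 ℕ.+ n)) oneL)
    (mulL (invMonic (br 1))
    (mulL (invMonic (br (2 ℕ.+ n)))
          (prodRange n (λ j → powL (invMonic (br (suc j))) (q ^ (suc n ∸ j)))))))

{-# OPTIONS --safe #-}

-- Write ℓ_d = ∏_{1≤i≤d} (θ - θ^(q^i)).  Summing partial fractions over one coefficient of the monic polynomial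
-- a of degree d at a time gives Σ_a 1/a(y) = 1/ℓ_d(y) and Σ_a a(t)/a(y) = ∏_{i<d} (t - y^(q^i)) / ℓ_d(y).
-- Since a(θ)^Q = a(θ^Q) for Q = q^k, taking t = θ and y = θ^Q yields S_d(q^k - 1) in closed form, and
-- S_d(sQ) = S_d(s)^Q.  With these values the inner sums telescope: for Q = q^m and
-- T_d = ℓ_d / ℓ_{d-m}^Q one has T_{d+1} - T_d = (θ - θ^Q) ℓ_d / ℓ_{d+1-m}^Q.  So the truncated multizeta value is
-- ratio · Σ_{d<D} S_d(q^(n+2)) plus a remainder proportional to S_D(q^(n+2)), which tends to 0 as D grows.

module Submission where

open import Defs
open import Level using (0ℓ)
open import Algebra.Bundles using (CommutativeRing; RawRing)
import Algebra.Solver.Ring as RingSolver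
open import Algebra.Solver.Ring.AlmostCommutativeRing using (fromCommutativeRing; _-Raw-AlmostCommutative⟶_)
open import Data.Empty using (⊥-elim)
open import Data.Integer as ℤ using (ℤ)
import Data.Integer.Properties as ℤₚ
import Data.Integer.Solver as ℤSolver
open import Data.List as List using (List; []; _∷_; [_]; _++_; length; foldr; applyUpTo)
open import Data.List.Membership.Propositional using (_∈_)
open import Data.List.Membership.Propositional.Properties using (∈-∃++; ∈-map⁺)
open import Data.List.Membership.Propositional.Properties.WithK using (unique∧set⇒bag)
import Data.List.Properties as Listₚ
open import Data.List.Relation.Binary.BagAndSetEquality using (∼bag⇒↭)
open import Data.List.Relation.Binary.Permutation.Propositional using (_↭_; ↭-sym; ↭-trans; ↭-reflexive; ↭⇒↭ₛ)
open import Data.List.Relation.Binary.Permutation.Propositional.Properties using (shift; drop-∷; ↭-length; map⁺; ∈-resp-↭)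
import Data.List.Relation.Binary.Permutation.Setoid.Properties as Permₛ
open import Data.List.Relation.Unary.All as All using (All; []; _∷_)
import Data.List.Relation.Unary.All.Properties as Allₚ
open import Data.List.Relation.Unary.AllPairs using (_∷_)
open import Data.List.Relation.Unary.Any using (here; there)
open import Data.List.Relation.Unary.Unique.Propositional using (Unique)
import Data.List.Relation.Unary.Unique.Propositional.Properties as Uniqueₚ
open import Data.Maybe using (Maybe; just; nothing)
open import Data.Nat as ℕ using (ℕ; zero; suc; _∸_; _≤_; _<_; z≤n; s≤s; NonZero)
import Data.Nat.Properties as ℕₚ
open import Data.Product using (_,_; proj₁; proj₂; ∃) renaming (_×_ to _∧_)
open import Data.Sum using (_⊎_; inj₁; inj₂)
open import Data.Vec as Vec using (Vec; []; _∷_; _∷ʳ_; replicate; zipWith)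
open import Function.Base using (_∘_; id)
open import Function.Bundles using (mk⇔)
open import Relation.Binary.Definitions using (tri<; tri≈; tri>)
open import Relation.Binary.PropositionalEquality as ≡ using (_≡_; _≢_; cong; cong₂; subst)
open import Relation.Nullary using (yes; no; contradiction)

-- F is given only as a finite list of elements with field operations, and the Laurent series are
-- treated as a commutative ring; this shapes the proof in two ways. Additivity of the q-power map
-- and the sum of `(X + cY)^(q-1)` over c are first read as statements about coefficient vectors
-- with entries in F. There both sides have degree below q and agree at all q points of F, so the
-- vectors coincide and may be evaluated in any F-algebra. Inverses are passed along as data with
-- their defining equations, so that everything up to the truncated evaluation is an identity in a
-- commutative ring. The partial fractions carry two independent variables because S_d(q^k - 1)
-- needs a polynomial at one point divided by the same polynomial at another; t = y = θ gives
-- S_d(1). The numerator [n+2] - 1 arises because the last telescoping leaves two truncations of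
-- ζ(q^(n+2)), weighted by θ - θ^(q^(n+2)) and by 1, whose lengths differ by one term; that extra
-- term is the remainder.

module RingKit {c ℓ} (R : CommutativeRing c ℓ) where
  open CommutativeRing R
  open import Algebra.Properties.Ring ring using (-‿distribˡ-*; -‿distribʳ-*)
  open import Algebra.Properties.AbelianGroup +-abelianGroup using (⁻¹-∙-comm; ⁻¹-involutive; ε⁻¹≈ε)
  open import Algebra.Properties.Semiring.Mult semiring using (_×_; ×-homo-+; ×1-homo-*; ×-congˡ)
  open import Algebra.Properties.CommutativeSemigroup +-commutativeSemigroup using (interchange)
  open import Relation.Binary.Reasoning.Setoid setoid

  -- Coefficients for the ring solver: (a , b) stands for the integer a - b.
  private
    differences : RawRing 0ℓ 0ℓ
    differences = record
      { Carrier = ℕ ∧ ℕ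
      ; _≈_ = _≡_
      ; _+_ = λ (a , b) (a′ , b′) → a ℕ.+ a′ , b ℕ.+ b′
      ; _*_ = λ (a , b) (a′ , b′) → a ℕ.* a′ ℕ.+ b ℕ.* b′ , a ℕ.* b′ ℕ.+ b ℕ.* a′
      ; -_ = λ (a , b) → b , a
      ; 0# = 0 , 0
      ; 1# = 1 , 0
      }

    ⟪_⟫ : ℕ ∧ ℕ → Carrier
    ⟪ a , b ⟫ = a × 1# + - (b × 1#)

    *-expand : ∀ x y u v → (x + - y) * (u + - v) ≈ (x * u + y * v) + - (x * v + y * u)
    *-expand x y u v = begin
      (x + - y) * (u + - v)                              ≈⟨ distribʳ _ _ _ ⟩
      x * (u + - v) + - y * (u + - v)                    ≈⟨ +-cong (distribˡ _ _ _) (distribˡ _ _ _) ⟩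
      (x * u + x * - v) + (- y * u + - y * - v)          ≈⟨ +-congˡ (+-comm _ _) ⟩
      (x * u + x * - v) + (- y * - v + - y * u)          ≈⟨ interchange _ _ _ _ ⟩
      (x * u + - y * - v) + (x * - v + - y * u)          ≈⟨ +-cong (+-congˡ lem) (+-cong (sym (-‿distribʳ-* x v)) (sym (-‿distribˡ-* y u))) ⟩
      (x * u + y * v) + (- (x * v) + - (y * u))          ≈⟨ +-congˡ (⁻¹-∙-comm _ _) ⟩
      (x * u + y * v) + - (x * v + y * u)                ∎
      where
      lem : - y * - v ≈ y * v
      lem = begin
        - y * - v     ≈⟨ -‿distribˡ-* y (- v) ⟨
        - (y * - v)   ≈⟨ -‿cong (-‿distribʳ-* y v) ⟨
        - - (y * v)   ≈⟨ ⁻¹-involutive _ ⟩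
        y * v         ∎

    ×-pair : ∀ a b c d → (a ℕ.* b ℕ.+ c ℕ.* d) × 1# ≈ (a × 1#) * (b × 1#) + (c × 1#) * (d × 1#)
    ×-pair a b c d = trans (×-homo-+ 1# (a ℕ.* b) (c ℕ.* d)) (+-cong (×1-homo-* a b) (×1-homo-* c d))

    ⟪⟫-homomorphism : differences -Raw-AlmostCommutative⟶ fromCommutativeRing R
    ⟪⟫-homomorphism = record
      { ⟦_⟧ = ⟪_⟫
      ; +-homo = λ (a , b) (a′ , b′) → begin
          (a ℕ.+ a′) × 1# + - ((b ℕ.+ b′) × 1#)              ≈⟨ +-cong (×-homo-+ 1# a a′) (-‿cong (×-homo-+ 1# b b′)) ⟩
          (a × 1# + a′ × 1#) + - (b × 1# + b′ × 1#)          ≈⟨ +-congˡ (⁻¹-∙-comm _ _) ⟨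
          (a × 1# + a′ × 1#) + (- (b × 1#) + - (b′ × 1#))    ≈⟨ interchange _ _ _ _ ⟩
          ⟪ a , b ⟫ + ⟪ a′ , b′ ⟫                            ∎
      ; *-homo = λ (a , b) (a′ , b′) → begin
          (a ℕ.* a′ ℕ.+ b ℕ.* b′) × 1# + - ((a ℕ.* b′ ℕ.+ b ℕ.* a′) × 1#)
            ≈⟨ +-cong (×-pair a a′ b b′) (-‿cong (×-pair a b′ b a′)) ⟩
          _ ≈⟨ *-expand _ _ _ _ ⟨
          ⟪ a , b ⟫ * ⟪ a′ , b′ ⟫  ∎
      ; -‿homo = λ (a , b) → begin
          b × 1# + - (a × 1#)        ≈⟨ +-congʳ (⁻¹-involutive _) ⟨
          - - (b × 1#) + - (a × 1#)  ≈⟨ +-comm _ _ ⟩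
          - (a × 1#) + - - (b × 1#)  ≈⟨ ⁻¹-∙-comm _ _ ⟩
          - ⟪ a , b ⟫                ∎
      ; 0-homo = -‿inverseʳ 0#
      ; 1-homo = trans (+-cong (+-identityʳ 1#) ε⁻¹≈ε) (+-identityʳ 1#)
      }

    cross : ∀ x y u v → x + v ≈ u + y → x + - y ≈ u + - v
    cross x y u v eq = begin
      x + - y                       ≈⟨ +-identityʳ _ ⟨
      (x + - y) + 0#                ≈⟨ +-congˡ (-‿inverseʳ v) ⟨
      (x + - y) + (v + - v)         ≈⟨ interchange _ _ _ _ ⟩
      (x + v) + (- y + - v)         ≈⟨ +-congʳ eq ⟩
      (u + y) + (- y + - v)         ≈⟨ +-congˡ (+-comm _ _) ⟩
      (u + y) + (- v + - y)         ≈⟨ interchange _ _ _ _ ⟩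
      (u + - v) + (y + - y)         ≈⟨ +-congˡ (-‿inverseʳ y) ⟩
      (u + - v) + 0#                ≈⟨ +-identityʳ _ ⟩
      u + - v                       ∎

    _≟_ : ∀ p p′ → Maybe (⟪ p ⟫ ≈ ⟪ p′ ⟫)
    (a , b) ≟ (a′ , b′) with a ℕ.+ b′ ℕₚ.≟ a′ ℕ.+ b
    ... | no _ = nothing
    ... | yes eq = just (cross _ _ _ _ (begin
      a × 1# + b′ × 1#     ≈⟨ ×-homo-+ 1# a b′ ⟨
      (a ℕ.+ b′) × 1#      ≈⟨ ×-congˡ eq ⟩
      (a′ ℕ.+ b) × 1#      ≈⟨ ×-homo-+ 1# a′ b ⟩
      a′ × 1# + b × 1#     ∎))

  module Solver = RingSolver differences (fromCommutativeRing R) ⟪⟫-homomorphism _≟_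

-- Finite sums over lists in a commutative ring.

module ListSums {c ℓ} (R : CommutativeRing c ℓ) where
  open CommutativeRing R hiding (zero)
  open import Algebra.Properties.CommutativeSemigroup +-commutativeSemigroup using (interchange)
  open import Algebra.Properties.Semiring.Mult semiring using (_×_)
  open import Relation.Binary.Reasoning.Setoid setoid

  ∑ : ∀ {a} {A : Set a} → List A → (A → Carrier) → Carrier
  ∑ xs f = foldr _+_ 0# (List.map f xs)

  infix 5 ∑
  syntax ∑ xs (λ x → e) = ∑[ x ∈ xs ] e

  module _ {a} {A : Set a} where
    ∑-cong : ∀ (xs : List A) {f g : A → Carrier} → (∀ x → f x ≈ g x) → ∑ xs f ≈ ∑ xs g
    ∑-cong [] eq = refl
    ∑-cong (x ∷ xs) eq = +-cong (eq x) (∑-cong xs eq)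

    ∑-+ : ∀ (xs : List A) (f g : A → Carrier) → (∑[ x ∈ xs ] f x + g x) ≈ ∑ xs f + ∑ xs g
    ∑-+ [] f g = sym (+-identityˡ 0#)
    ∑-+ (x ∷ xs) f g = trans (+-congˡ (∑-+ xs f g)) (interchange _ _ _ _)

    ∑-*ˡ : ∀ (xs : List A) c (f : A → Carrier) → c * ∑ xs f ≈ (∑[ x ∈ xs ] c * f x)
    ∑-*ˡ [] c f = zeroʳ c
    ∑-*ˡ (x ∷ xs) c f = trans (distribˡ _ _ _) (+-congˡ (∑-*ˡ xs c f))

    ∑-const : ∀ (xs : List A) c → (∑[ _ ∈ xs ] c) ≈ length xs × c
    ∑-const [] c = refl
    ∑-const (x ∷ xs) c = +-congˡ (∑-const xs c)

    ∑-++ : ∀ (xs ys : List A) (f : A → Carrier) → ∑ (xs ++ ys) f ≈ ∑ xs f + ∑ ys f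
    ∑-++ [] ys f = sym (+-identityˡ _)
    ∑-++ (x ∷ xs) ys f = trans (+-congˡ (∑-++ xs ys f)) (sym (+-assoc _ _ _))

    ∑-↭ : ∀ {xs ys : List A} (f : A → Carrier) → xs ↭ ys → ∑ xs f ≈ ∑ ys f
    ∑-↭ f _↭_.refl = refl
    ∑-↭ f (_↭_.prep x p) = +-congˡ (∑-↭ f p)
    ∑-↭ f (_↭_.swap x y p) = begin
      f x + (f y + _)  ≈⟨ +-assoc _ _ _ ⟨
      (f x + f y) + _  ≈⟨ +-cong (+-comm _ _) (∑-↭ f p) ⟩
      (f y + f x) + _  ≈⟨ +-assoc _ _ _ ⟩
      f y + (f x + _)  ∎
    ∑-↭ f (_↭_.trans p p′) = trans (∑-↭ f p) (∑-↭ f p′)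

    ∑-zero : ∀ (xs : List A) → (∑[ _ ∈ xs ] 0#) ≈ 0#
    ∑-zero [] = refl
    ∑-zero (x ∷ xs) = trans (+-identityˡ _) (∑-zero xs)

  module _ {a b} {A : Set a} {B : Set b} where
    ∑-map : ∀ (h : A → B) (xs : List A) (f : B → Carrier) → ∑ (List.map h xs) f ≈ ∑ xs (f ∘ h)
    ∑-map h xs f = reflexive (≡.cong (foldr _+_ 0#) (≡.sym (Listₚ.map-∘ xs)))

    ∑-concatMap : ∀ (h : A → List B) (xs : List A) (f : B → Carrier) →
                  ∑ (List.concatMap h xs) f ≈ (∑[ x ∈ xs ] ∑ (h x) f)
    ∑-concatMap h [] f = refl
    ∑-concatMap h (x ∷ xs) f = trans (∑-++ (h x) _ f) (+-congˡ (∑-concatMap h xs f))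

    ∑-swap : ∀ (xs : List A) (ys : List B) (f : A → B → Carrier) →
             (∑[ x ∈ xs ] ∑[ y ∈ ys ] f x y) ≈ (∑[ y ∈ ys ] ∑[ x ∈ xs ] f x y)
    ∑-swap [] ys f = sym (∑-zero ys)
    ∑-swap (x ∷ xs) ys f = trans (+-congˡ (∑-swap xs ys f)) (sym (∑-+ ys _ _))

-- Finite fields: permutations of F, Fermat, power sums, root counting.

module FieldFacts (𝔽 : FiniteField) where
  open FiniteField 𝔽

  F-ring : CommutativeRing 0ℓ 0ℓ
  F-ring = record { isCommutativeRing = isCommutativeRing }

  open CommutativeRing F-ring
    using (semiring; +-identityˡ; +-identityʳ; -‿inverseʳ; +-comm; *-comm; *-assoc; *-identityˡ; *-identityʳ; zeroʳ; zeroˡ)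
  open import Algebra.Properties.Semiring.Exp semiring public using (_^_)
  open import Algebra.Properties.Semiring.Mult semiring public using (_×_)
  open RingKit F-ring using (module Solver)
  open Solver using (solve; _:+_; _:*_; _:-_; :-_; _:=_)
  open ListSums F-ring
  open ≡.≡-Reasoning

  +-cancelˡ : ∀ a {x y} → a + x ≡ a + y → x ≡ y
  +-cancelˡ a {x} {y} eq = begin
    x                ≡⟨ solve 2 (λ a x → x := (a :+ x) :- a) ≡.refl a x ⟩
    a + x + - a      ≡⟨ cong (λ u → u + - a) eq ⟩
    a + y + - a      ≡⟨ solve 2 (λ a y → (a :+ y) :- a := y) ≡.refl a y ⟩
    y                ∎

  *-cancelˡ : ∀ {a} → a ≢ 0# → ∀ {x y} → a * x ≡ a * y → x ≡ y
  *-cancelˡ {a} a≢0 {x} {y} eq = begin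
    x                ≡⟨ *-identityˡ x ⟨
    1# * x           ≡⟨ cong (_* x) (inverse a a≢0) ⟨
    a * a ⁻¹ * x     ≡⟨ solve 3 (λ a b x → a :* b :* x := b :* (a :* x)) ≡.refl a (a ⁻¹) x ⟩
    a ⁻¹ * (a * x)   ≡⟨ cong (a ⁻¹ *_) eq ⟩
    a ⁻¹ * (a * y)   ≡⟨ solve 3 (λ a b x → b :* (a :* x) := a :* b :* x) ≡.refl a (a ⁻¹) y ⟩
    a * a ⁻¹ * y     ≡⟨ cong (_* y) (inverse a a≢0) ⟩
    1# * y           ≡⟨ *-identityˡ y ⟩
    y                ∎

  -- `elems` lists F without repetition, and its image under a bijection is again complete and
  -- without repetition, so the two lists are the same bag. Reindexing a sum or product over F by a
  -- translation or a scaling rests on this.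
  bijection⇒↭ : ∀ (f g : F → F) → (∀ x → g (f x) ≡ x) → (∀ x → f (g x) ≡ x) → List.map f elems ↭ elems
  bijection⇒↭ f g gf fg = ∼bag⇒↭ (unique∧set⇒bag
    (Uniqueₚ.map⁺ (λ {x} {y} eq → ≡.trans (≡.sym (gf x)) (≡.trans (cong g eq) (gf y))) unique)
    unique
    (λ {x} → mk⇔ (λ _ → complete x) (λ _ → subst (_∈ List.map f elems) (fg x) (∈-map⁺ f (complete (g x))))))

  translate : ∀ a → List.map (a +_) elems ↭ elems
  translate a = bijection⇒↭ (a +_) (- a +_)
    (λ x → solve 2 (λ a x → :- a :+ (a :+ x) := x) ≡.refl a x)
    (λ x → solve 2 (λ a x → a :+ (:- a :+ x) := x) ≡.refl a x)

  scale : ∀ {a} → a ≢ 0# → List.map (a *_) elems ↭ elems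
  scale {a} a≢0 = bijection⇒↭ (a *_) (a ⁻¹ *_)
    (λ x → ≡.trans (solve 3 (λ a b x → b :* (a :* x) := a :* b :* x) ≡.refl a (a ⁻¹) x) (unit x))
    (λ x → ≡.trans (≡.sym (*-assoc a (a ⁻¹) x)) (unit x))
    where
    unit : ∀ x → a * a ⁻¹ * x ≡ x
    unit x = ≡.trans (cong (_* x) (inverse a a≢0)) (*-identityˡ x)

  -- Translation by 1 permutes F, so adding q copies of 1 to the sum of all elements leaves it
  -- unchanged. This takes the place of a characteristic.
  q×1≡0 : q × 1# ≡ 0#
  q×1≡0 = +-cancelˡ (∑ elems λ x → x) (begin
    ∑ elems (λ x → x) + q × 1#                        ≡⟨ +-comm _ _ ⟩
    q × 1# + ∑ elems (λ x → x)                        ≡⟨ cong (_+ ∑ elems (λ x → x)) (∑-const elems 1#) ⟨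
    ∑ elems (λ _ → 1#) + ∑ elems (λ x → x)            ≡⟨ ∑-+ elems _ _ ⟨
    ∑ elems (1# +_)                                   ≡⟨ ∑-map (1# +_) elems (λ x → x) ⟨
    ∑ (List.map (1# +_) elems) (λ x → x)              ≡⟨ ∑-↭ _ (translate 1#) ⟩
    ∑ elems (λ x → x)                                 ≡⟨ +-identityʳ _ ⟨
    ∑ elems (λ x → x) + 0#                            ∎)

  private
    split : ∃ λ ys → elems ↭ 0# ∷ ys
    split with ys , zs , eq ← ∈-∃++ (complete 0#) = ys ++ zs , ↭-trans (↭-reflexive eq) (shift 0# ys zs)

  nonzeros : List F
  nonzeros = proj₁ split

  elems↭ : elems ↭ 0# ∷ nonzeros
  elems↭ = proj₂ split

  q-1 : ℕ
  q-1 = length nonzeros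

  q≡ : q ≡ suc q-1
  q≡ = ↭-length elems↭

  nonzeros-≢0 : All (_≢ 0#) nonzeros
  nonzeros-≢0 with Permₛ.Unique-resp-↭ (≡.setoid F) (↭⇒↭ₛ elems↭) unique
  ... | 0≢ ∷ _ = All.map (λ 0≢x x≡0 → 0≢x (≡.sym x≡0)) 0≢

  ∏ : List F → F
  ∏ = foldr _*_ 1#

  ∏-scale : ∀ x ys → ∏ (List.map (x *_) ys) ≡ x ^ length ys * ∏ ys
  ∏-scale x [] = ≡.sym (*-identityˡ 1#)
  ∏-scale x (y ∷ ys) = ≡.trans (cong (x * y *_) (∏-scale x ys))
    (solve 4 (λ x y u v → x :* y :* (u :* v) := x :* u :* (y :* v)) ≡.refl x y _ _)

  *-≢0 : ∀ {x y} → x ≢ 0# → y ≢ 0# → x * y ≢ 0#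
  *-≢0 {x} {y} x≢0 y≢0 eq = y≢0 (*-cancelˡ x≢0 (≡.trans eq (≡.sym (zeroʳ x))))

  ∏-≢0 : ∀ {ys} → All (_≢ 0#) ys → ∏ ys ≢ 0#
  ∏-≢0 [] = λ 1≡0 → 0≢1 (≡.sym 1≡0)
  ∏-≢0 (y≢0 ∷ ys≢0) = *-≢0 y≢0 (∏-≢0 ys≢0)

  -- Multiplication by `x` permutes the nonzero elements, so their product absorbs the factor
  -- `x ^ q-1`; that product is nonzero and cancels.
  x^[q-1]≡1 : ∀ {x} → x ≢ 0# → x ^ q-1 ≡ 1#
  x^[q-1]≡1 {x} x≢0 = *-cancelˡ (∏-≢0 nonzeros-≢0) (begin
    ∏ nonzeros * x ^ q-1              ≡⟨ *-comm _ _ ⟩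
    x ^ q-1 * ∏ nonzeros              ≡⟨ ∏-scale x nonzeros ⟨
    ∏ (List.map (x *_) nonzeros)      ≡⟨ Permₛ.foldr-commMonoid (≡.setoid F) (CommutativeRing.*-isCommutativeMonoid F-ring) (↭⇒↭ₛ (drop-∷ scaled)) ⟩
    ∏ nonzeros                        ≡⟨ *-identityʳ _ ⟨
    ∏ nonzeros * 1#                   ∎)
    where
    scaled : 0# ∷ List.map (x *_) nonzeros ↭ 0# ∷ nonzeros
    scaled = ↭-trans (↭-reflexive (cong (_∷ List.map (x *_) nonzeros) (≡.sym (zeroʳ x))))
      (↭-trans (map⁺ (x *_) (↭-sym elems↭)) (↭-trans (scale x≢0) elems↭))

  -- Equality in F is not assumed decidable; the case split comes from where `x` occurs in the list
  -- `0# ∷ nonzeros`.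
  nonzero-cases : ∀ {p} (P : F → Set p) → P 0# → (∀ {x} → x ≢ 0# → P x) → ∀ x → P x
  nonzero-cases P P0 Px x with ∈-resp-↭ elems↭ (complete x)
  ... | here ≡.refl = P0
  ... | there x∈ = Px (All.lookup nonzeros-≢0 x∈)

  fermat : ∀ x → x ^ q ≡ x
  fermat x rewrite q≡ = nonzero-cases (λ x → x * x ^ q-1 ≡ x) (zeroˡ _)
    (λ {x} x≢0 → ≡.trans (cong (x *_) (x^[q-1]≡1 x≢0)) (*-identityʳ x)) x

  -- The exponent `q-1` must be positive: 1 differs from 0 and therefore occurs among `nonzeros`.
  0^[q-1]≡0 : 0# ^ q-1 ≡ 0#
  0^[q-1]≡0 with nonzeros | ∈-resp-↭ elems↭ (complete 1#)
  ... | _ | here 1≡0 = ⊥-elim (0≢1 (≡.sym 1≡0))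
  ... | _ ∷ _ | there _ = zeroˡ _

  ∑-[q-1]th-powers : ∑ elems (_^ q-1) ≡ - 1#
  ∑-[q-1]th-powers = begin
    ∑ elems (_^ q-1)                      ≡⟨ ∑-↭ _ elems↭ ⟩
    0# ^ q-1 + ∑ nonzeros (_^ q-1)        ≡⟨ cong₂ _+_ 0^[q-1]≡0 (ones nonzeros-≢0) ⟩
    0# + q-1 × 1#                         ≡⟨ +-identityˡ _ ⟩
    q-1 × 1#                              ≡⟨ +-cancelˡ 1# (≡.trans (≡.trans (≡.sym (cong (_× 1#) q≡)) q×1≡0) (≡.sym (-‿inverseʳ 1#))) ⟩
    - 1#                                  ∎
    where
    ones : ∀ {ys} → All (_≢ 0#) ys → ∑ ys (_^ q-1) ≡ length ys × 1#
    ones [] = ≡.refl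
    ones (y≢0 ∷ ys≢0) = cong₂ _+_ (x^[q-1]≡1 y≢0) (ones ys≢0)

  horner : ∀ {n} → Vec F n → F → F
  horner [] x = 0#
  horner (a ∷ p) x = a + x * horner p x

  -- Synthetic division by `x - r`: each entry is the value at `r` of the part of the polynomial
  -- above it.
  quotient : ∀ {n} → F → Vec F (suc n) → Vec F n
  quotient {zero} r _ = []
  quotient {suc n} r (a ∷ p) = horner p r ∷ quotient r p

  horner-quotient : ∀ {n} r (p : Vec F (suc n)) x → horner p x ≡ (x + - r) * horner (quotient r p) x + horner p r
  horner-quotient {zero} r (a ∷ []) x = begin
    a + x * 0#                          ≡⟨ cong (a +_) (≡.trans (zeroʳ x) (≡.sym (zeroʳ r))) ⟩
    a + r * 0#                          ≡⟨ +-identityˡ _ ⟨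
    0# + (a + r * 0#)                   ≡⟨ cong (_+ (a + r * 0#)) (zeroʳ (x + - r)) ⟨
    (x + - r) * 0# + (a + r * 0#)       ∎
  horner-quotient {suc n} r (a ∷ p) x = begin
    a + x * horner p x
      ≡⟨ cong (λ u → a + x * u) (horner-quotient r p x) ⟩
    a + x * ((x + - r) * horner (quotient r p) x + horner p r)
      ≡⟨ solve 5 (λ a x r u s → a :+ x :* ((x :- r) :* u :+ s) := (x :- r) :* (s :+ x :* u) :+ (a :+ r :* s)) ≡.refl a x r _ _ ⟩
    (x + - r) * (horner p r + x * horner (quotient r p) x) + (a + r * horner p r) ∎

  quotient-zero : ∀ {n} r (p : Vec F (suc n)) → horner p r ≡ 0# → quotient r p ≡ replicate n 0# → p ≡ replicate (suc n) 0#
  quotient-zero {zero} r (a ∷ []) root _ = cong (_∷ []) (≡.trans (≡.sym (≡.trans (cong (a +_) (zeroʳ r)) (+-identityʳ a))) root)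
  quotient-zero {suc n} r (a ∷ p) root quot≡0 = cong₂ _∷_ a≡0 (quotient-zero r p p[r]≡0 (cong Vec.tail quot≡0))
    where
    p[r]≡0 : horner p r ≡ 0#
    p[r]≡0 = cong Vec.head quot≡0
    a≡0 : a ≡ 0#
    a≡0 = begin
      a                    ≡⟨ +-identityʳ a ⟨
      a + 0#               ≡⟨ cong (a +_) (zeroʳ r) ⟨
      a + r * 0#           ≡⟨ cong (λ u → a + r * u) p[r]≡0 ⟨
      a + r * horner p r   ≡⟨ root ⟩
      0#                   ∎

  -- Dividing out the root `r` shortens the vector by one, and each remaining root survives because
  -- `x - r` is nonzero there. A vector of length n stands for degree below n, so n roots are the
  -- right bound.
  too-many-roots : ∀ {n} (p : Vec F n) (xs : List F) → Unique xs → n ≤ length xs → All (λ x → horner p x ≡ 0#) xs →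
                   p ≡ replicate n 0#
  too-many-roots [] _ _ _ _ = ≡.refl
  too-many-roots {suc n} p (r ∷ xs) (r≢ ∷ uniq) (s≤s n≤) (root ∷ roots) =
    quotient-zero r p root (too-many-roots (quotient r p) xs uniq n≤ (All.zipWith quotient-root (r≢ , roots)))
    where
    quotient-root : ∀ {x} → (r ≢ x) ∧ (horner p x ≡ 0#) → horner (quotient r p) x ≡ 0#
    quotient-root {x} (r≢x , px≡0) = *-cancelˡ {x + - r} x-r≢0 (begin
      (x + - r) * horner (quotient r p) x                ≡⟨ +-identityʳ _ ⟨
      (x + - r) * horner (quotient r p) x + 0#           ≡⟨ cong ((x + - r) * horner (quotient r p) x +_) root ⟨
      (x + - r) * horner (quotient r p) x + horner p r   ≡⟨ horner-quotient r p x ⟨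
      horner p x                                         ≡⟨ px≡0 ⟩
      0#                                                 ≡⟨ zeroʳ _ ⟨
      (x + - r) * 0#                                     ∎)
      where
      x-r≢0 : x + - r ≢ 0#
      x-r≢0 eq = r≢x (begin
        r              ≡⟨ +-identityˡ r ⟨
        0# + r         ≡⟨ cong (_+ r) eq ⟨
        x + - r + r    ≡⟨ solve 2 (λ x r → x :- r :+ r := x) ≡.refl x r ⟩
        x              ∎)

  horner-sub : ∀ {n} (p p′ : Vec F n) x → horner (zipWith (λ a b → a + - b) p p′) x ≡ horner p x + - horner p′ x
  horner-sub [] [] x = ≡.sym (-‿inverseʳ 0#)
  horner-sub (a ∷ p) (b ∷ p′) x = ≡.trans (cong (λ u → a + - b + x * u) (horner-sub p p′ x))
    (solve 5 (λ a b x u v → a :- b :+ x :* (u :- v) := (a :+ x :* u) :- (b :+ x :* v)) ≡.refl a b x _ _)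

  -- The bridge from functions on F to coefficients: for length at most q, the elements of F supply
  -- enough roots of the difference.
  polynomial-ext : ∀ {n} (p p′ : Vec F n) → n ≤ q → (∀ x → horner p x ≡ horner p′ x) → p ≡ p′
  polynomial-ext {n} p p′ n≤q eq = unzip p p′ (too-many-roots (zipWith (λ a b → a + - b) p p′) elems unique n≤q
    (All.universal (λ x → ≡.trans (horner-sub p p′ x) (≡.trans (cong (_+ - horner p′ x) (eq x)) (-‿inverseʳ _))) elems))
    where
    unzip : ∀ {n} (p p′ : Vec F n) → zipWith (λ a b → a + - b) p p′ ≡ replicate n 0# → p ≡ p′
    unzip [] [] _ = ≡.refl
    unzip (a ∷ p) (b ∷ p′) eq = cong₂ _∷_
      (begin
        a              ≡⟨ solve 2 (λ a b → a := a :- b :+ b) ≡.refl a b ⟩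
        a + - b + b    ≡⟨ cong (_+ b) (cong Vec.head eq) ⟩
        0# + b         ≡⟨ +-identityˡ b ⟩
        b              ∎)
      (unzip p p′ (cong Vec.tail eq))

-- Both F itself and the Laurent series are instances. An identity between coefficient vectors is
-- established in the first, where `polynomial-ext` applies, and evaluated in the second.
record FieldAlgebra (𝔽 : FiniteField) : Set₁ where
  private module F = FiniteField 𝔽
  field
    ring : CommutativeRing 0ℓ 0ℓ
  open CommutativeRing ring
  field
    ι : F.F → Carrier
    ι-+ : ∀ a b → ι (a F.+ b) ≈ ι a + ι b
    ι-* : ∀ a b → ι (a F.* b) ≈ ι a * ι b
    ι-0 : ι F.0# ≈ 0#
    ι-1 : ι F.1# ≈ 1#

-- Binary forms over F and powers of a linear form.

module Forms {𝔽 : FiniteField} (A : FieldAlgebra 𝔽) where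
  open FiniteField 𝔽 using (F)
  private module F = FiniteField 𝔽
  open FieldAlgebra A using (ring; ι; ι-+; ι-*; ι-0)
  open CommutativeRing ring hiding (ring; zero)
  open import Algebra.Properties.CommutativeSemiring.Exp commutativeSemiring
  open RingKit ring using (module Solver)
  open Solver using (solve; _:+_; _:*_; _:=_)
  open import Relation.Binary.Reasoning.Setoid setoid

  -- A vector of length n + 1 is read as a binary form of degree n,
  -- with its first entry the coefficient of Yⁿ.
  form : ∀ {n} → Vec F n → Carrier → Carrier → Carrier
  form [] X Y = 0#
  form (_∷_ {n} a p) X Y = ι a * Y ^ n + X * form p X Y

  private
    0*-+ : ∀ x y → ι F.0# * x + y ≈ y
    0*-+ x y = trans (+-congʳ (trans (*-congʳ ι-0) (zeroˡ x))) (+-identityˡ y)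

  form-∷ʳ : ∀ {n} (p : Vec F n) a X Y → form (p ∷ʳ a) X Y ≈ Y * form p X Y + ι a * X ^ n
  form-∷ʳ [] a X Y = begin
    ι a * 1# + X * 0#   ≈⟨ +-congˡ (trans (zeroʳ X) (sym (zeroʳ Y))) ⟩
    ι a * 1# + Y * 0#   ≈⟨ +-comm _ _ ⟩
    Y * 0# + ι a * 1#   ∎
  form-∷ʳ {suc n} (b ∷ p) a X Y = begin
    ι b * (Y * Y ^ n) + X * form (p ∷ʳ a) X Y
      ≈⟨ +-congˡ (*-congˡ (form-∷ʳ p a X Y)) ⟩
    ι b * (Y * Y ^ n) + X * (Y * form p X Y + ι a * X ^ n)
      ≈⟨ solve 7 (λ a b X Y u v w → b :* (Y :* u) :+ X :* (Y :* v :+ a :* w) := Y :* (b :* u :+ X :* v) :+ a :* (X :* w))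
          refl (ι a) (ι b) X Y (Y ^ n) (form p X Y) (X ^ n) ⟩
    Y * (ι b * Y ^ n + X * form p X Y) + ι a * (X * X ^ n) ∎

  form-+ : ∀ {n} (p p′ : Vec F n) X Y → form (zipWith F._+_ p p′) X Y ≈ form p X Y + form p′ X Y
  form-+ [] [] X Y = sym (+-identityˡ 0#)
  form-+ (_∷_ {n} a p) (b ∷ p′) X Y = trans (+-cong (*-congʳ (ι-+ a b)) (*-congˡ (form-+ p p′ X Y)))
    (solve 6 (λ a b Z X u v → (a :+ b) :* Z :+ X :* (u :+ v) := (a :* Z :+ X :* u) :+ (b :* Z :+ X :* v))
      refl (ι a) (ι b) (Y ^ n) X _ _)

  form-* : ∀ {n} c (p : Vec F n) X Y → form (Vec.map (c F.*_) p) X Y ≈ ι c * form p X Y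
  form-* c [] X Y = sym (zeroʳ _)
  form-* c (_∷_ {n} a p) X Y = trans (+-cong (*-congʳ (ι-* c a)) (*-congˡ (form-* c p X Y)))
    (solve 5 (λ c a Z X u → (c :* a) :* Z :+ X :* (c :* u) := c :* (a :* Z :+ X :* u)) refl (ι c) (ι a) (Y ^ n) X _)

  form-0 : ∀ n X Y → form (replicate n F.0#) X Y ≈ 0#
  form-0 zero X Y = refl
  form-0 (suc n) X Y = trans (0*-+ _ _) (trans (*-congˡ (form-0 n X Y)) (zeroʳ X))

  form-Yⁿ : ∀ n a X Y → form (a ∷ replicate n F.0#) X Y ≈ ι a * Y ^ n
  form-Yⁿ n a X Y = trans (+-congˡ (trans (*-congˡ (form-0 n X Y)) (zeroʳ X))) (+-identityʳ _)

module LinearPowers (𝔽 : FiniteField) where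
  open FiniteField 𝔽
  open FieldFacts 𝔽

  -- The coefficients of ((X + cY)ⁿ - Xⁿ) / Y.
  linearPower : F → ∀ n → Vec F n
  linearPower c zero = []
  linearPower c (suc n) = zipWith _+_ (0# ∷ linearPower c n) (Vec.map (c *_) (linearPower c n ∷ʳ 1#))

  module _ (A : FieldAlgebra 𝔽) where
    open FieldAlgebra A using (ι; ι-0; ι-1)
    private module R = CommutativeRing (FieldAlgebra.ring A)
    open R using (_≈_; setoid; commutativeSemiring)
    open import Algebra.Properties.CommutativeSemiring.Exp commutativeSemiring renaming (_^_ to _^′_)
    open RingKit (FieldAlgebra.ring A) using (module Solver)
    open Solver using (solve; _:+_; _:*_; _:=_)
    open import Relation.Binary.Reasoning.Setoid setoid
    open Forms A

    linearPower-form : ∀ c n X Y → (X R.+ ι c R.* Y) ^′ n ≈ X ^′ n R.+ Y R.* form (linearPower c n) X Y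
    linearPower-form c zero X Y = R.sym (R.trans (R.+-congˡ (R.zeroʳ Y)) (R.+-identityʳ _))
    linearPower-form c (suc n) X Y = begin
      (X R.+ ι c R.* Y) R.* (X R.+ ι c R.* Y) ^′ n
        ≈⟨ R.*-congˡ (linearPower-form c n X Y) ⟩
      (X R.+ ι c R.* Y) R.* (X ^′ n R.+ Y R.* P)
        ≈⟨ solve 5 (λ X Y c Xⁿ P → (X :+ c :* Y) :* (Xⁿ :+ Y :* P) := X :* Xⁿ :+ Y :* (X :* P :+ c :* (Y :* P :+ Xⁿ)))
            R.refl X Y (ι c) (X ^′ n) P ⟩
      X R.* X ^′ n R.+ Y R.* (X R.* P R.+ ι c R.* (Y R.* P R.+ X ^′ n))
        ≈⟨ R.+-congˡ (R.*-congˡ (R.+-cong low high)) ⟨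
      X R.* X ^′ n R.+ Y R.* (form (0# ∷ p) X Y R.+ form (Vec.map (c *_) (p ∷ʳ 1#)) X Y)
        ≈⟨ R.+-congˡ (R.*-congˡ (form-+ (0# ∷ p) (Vec.map (c *_) (p ∷ʳ 1#)) X Y)) ⟨
      X R.* X ^′ n R.+ Y R.* form (linearPower c (suc n)) X Y ∎
      where
      p = linearPower c n
      P = form p X Y
      low : form (0# ∷ p) X Y ≈ X R.* P
      low = R.trans (R.+-congʳ (R.trans (R.*-congʳ ι-0) (R.zeroˡ _))) (R.+-identityˡ _)
      high : form (Vec.map (c *_) (p ∷ʳ 1#)) X Y ≈ ι c R.* (Y R.* P R.+ X ^′ n)
      high = R.trans (form-* c (p ∷ʳ 1#) X Y) (R.*-congˡ (R.trans (form-∷ʳ p 1# X Y)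
        (R.+-congˡ (R.trans (R.*-congʳ ι-1) (R.*-identityˡ _)))))

    linearPower-full : ∀ c n X Y → form (linearPower c n ∷ʳ 1#) X Y ≈ (X R.+ ι c R.* Y) ^′ n
    linearPower-full c n X Y = begin
      form (linearPower c n ∷ʳ 1#) X Y                      ≈⟨ form-∷ʳ (linearPower c n) 1# X Y ⟩
      Y R.* form (linearPower c n) X Y R.+ ι 1# R.* X ^′ n  ≈⟨ R.+-congˡ (R.trans (R.*-congʳ ι-1) (R.*-identityˡ _)) ⟩
      Y R.* form (linearPower c n) X Y R.+ X ^′ n           ≈⟨ R.+-comm _ _ ⟩
      X ^′ n R.+ Y R.* form (linearPower c n) X Y           ≈⟨ linearPower-form c n X Y ⟨
      (X R.+ ι c R.* Y) ^′ n                                ∎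

  selfAlgebra : FieldAlgebra 𝔽
  selfAlgebra = record
    { ring = F-ring ; ι = id ; ι-+ = λ _ _ → ≡.refl ; ι-* = λ _ _ → ≡.refl ; ι-0 = ≡.refl ; ι-1 = ≡.refl }

  open CommutativeRing F-ring using (*-identityˡ; *-identityʳ)
  open Forms selfAlgebra using (form)
  open ≡.≡-Reasoning

  1^n : ∀ n → 1# ^ n ≡ 1#
  1^n zero = ≡.refl
  1^n (suc n) = ≡.trans (*-identityˡ _) (1^n n)

  form≡horner : ∀ {n} (p : Vec F n) x → form p x 1# ≡ horner p x
  form≡horner [] x = ≡.refl
  form≡horner (_∷_ {n} a p) x = ≡.cong₂ _+_ (≡.trans (cong (a *_) (1^n n)) (*-identityʳ a)) (cong (x *_) (form≡horner p x))

  form-ext : ∀ {n} (p p′ : Vec F n) → n ≤ q → (∀ x → form p x 1# ≡ form p′ x 1#) → p ≡ p′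
  form-ext p p′ n≤q eq = polynomial-ext p p′ n≤q
    (λ x → ≡.trans (≡.sym (form≡horner p x)) (≡.trans (eq x) (form≡horner p′ x)))

  -- Both sides are polynomials in x of degree less than q, and by Fermat they agree on all of F.
  linearPower-q : linearPower 1# (suc q-1) ≡ 1# ∷ replicate q-1 0#
  linearPower-q = form-ext _ _ (ℕₚ.≤-reflexive (≡.sym q≡)) λ x → begin
    form (linearPower 1# (suc q-1)) x 1#    ≡⟨ *-identityˡ _ ⟨
    1# * form (linearPower 1# (suc q-1)) x 1#  ≡⟨ +-cancelˡ (x ^ suc q-1) (frobenius x) ⟩
    1#                                      ≡⟨ ≡.trans (*-identityˡ _) (1^n q-1) ⟨
    1# * 1# ^ q-1                           ≡⟨ Forms.form-Yⁿ selfAlgebra q-1 1# x 1# ⟨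
    form (1# ∷ replicate q-1 0#) x 1#       ∎
    where
    fermat′ : ∀ x → x ^ suc q-1 ≡ x
    fermat′ x = ≡.trans (cong (x ^_) (≡.sym q≡)) (fermat x)
    frobenius : ∀ x → x ^ suc q-1 + 1# * form (linearPower 1# (suc q-1)) x 1# ≡ x ^ suc q-1 + 1#
    frobenius x = begin
      x ^ suc q-1 + 1# * form (linearPower 1# (suc q-1)) x 1# ≡⟨ linearPower-form selfAlgebra 1# (suc q-1) x 1# ⟨
      (x + 1# * 1#) ^ suc q-1   ≡⟨ fermat′ _ ⟩
      x + 1# * 1#               ≡⟨ ≡.cong₂ _+_ (≡.sym (fermat′ x)) (*-identityʳ 1#) ⟩
      x ^ suc q-1 + 1#          ∎

  sumVec : ∀ {n} → (F → Vec F n) → List F → Vec F n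
  sumVec f [] = replicate _ 0#
  sumVec f (c ∷ cs) = zipWith _+_ (f c) (sumVec f cs)

  sumVec-form : ∀ (A : FieldAlgebra 𝔽) (let module R = CommutativeRing (FieldAlgebra.ring A)) {n} (f : F → Vec F n) cs X Y →
    Forms.form A (sumVec f cs) X Y R.≈ ListSums.∑ (FieldAlgebra.ring A) cs (λ c → Forms.form A (f c) X Y)
  sumVec-form A {n} f [] X Y = Forms.form-0 A n X Y
  sumVec-form A f (c ∷ cs) X Y = R.trans (Forms.form-+ A (f c) (sumVec f cs) X Y) (R.+-congˡ (sumVec-form A f cs X Y))
    where
    module R = CommutativeRing (FieldAlgebra.ring A)

  powers-[q-1] : F → Vec F (suc q-1)
  powers-[q-1] c = linearPower c q-1 ∷ʳ 1#

  -- At `Y = 1` the sum of `(x + c)^(q-1)` over c does not depend on `x`, by translation, and equals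
  -- -1. Its degree in `x` is below q, so only the coefficient of `Y^(q-1)` remains.
  ∑-linearPowers : sumVec powers-[q-1] elems ≡ - 1# ∷ replicate q-1 0#
  ∑-linearPowers = form-ext _ _ (ℕₚ.≤-reflexive (≡.sym q≡)) λ x → begin
    form (sumVec powers-[q-1] elems) x 1#               ≡⟨ sumVec-form selfAlgebra powers-[q-1] elems x 1# ⟩
    ∑ elems (λ c → form (powers-[q-1] c) x 1#)          ≡⟨ ∑-cong elems (λ c → ≡.trans (linearPower-full selfAlgebra c q-1 x 1#)
                                                              (cong (λ u → (x + u) ^ q-1) (*-identityʳ c))) ⟩
    ∑ elems (λ c → (x + c) ^ q-1)                       ≡⟨ ∑-map (x +_) elems (_^ q-1) ⟨
    ∑ (List.map (x +_) elems) (_^ q-1)                  ≡⟨ ∑-↭ (_^ q-1) (translate x) ⟩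
    ∑ elems (_^ q-1)                                    ≡⟨ ∑-[q-1]th-powers ⟩
    - 1#                                                ≡⟨ ≡.trans (cong (- 1# *_) (1^n q-1)) (*-identityʳ _) ⟨
    - 1# * 1# ^ q-1                                     ≡⟨ Forms.form-Yⁿ selfAlgebra q-1 (- 1#) x 1# ⟨
    form (- 1# ∷ replicate q-1 0#) x 1#                 ∎
    where open ListSums F-ring

-- The q-power map on an F-algebra.

module Frobenius {𝔽 : FiniteField} (A : FieldAlgebra 𝔽) where
  open FiniteField 𝔽 using (F; q; elems)
  open FieldFacts 𝔽 using (q-1; q≡; q×1≡0; fermat) renaming (_^_ to _^F_; _×_ to _×F_)
  private module F = FiniteField 𝔽
  open LinearPowers 𝔽
  open FieldAlgebra A using (ring; ι; ι-+; ι-*; ι-0; ι-1)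
  open CommutativeRing ring hiding (ring; zero)
  open import Algebra.Properties.CommutativeSemiring.Exp commutativeSemiring public
  open import Algebra.Properties.Semiring.Mult semiring using (_×_; ×-congʳ; ×-assoc-*)
  open RingKit ring using (module Solver)
  open Solver using (solve; _:*_; _:-_; :-_; _:=_; _:^_)
  open import Relation.Binary.Reasoning.Setoid setoid
  open import Algebra.Properties.AbelianGroup +-abelianGroup using (inverseˡ-unique)
  open ListSums ring
  open Forms A using (form; form-Yⁿ)

  ι-neg : ∀ a → ι (F.- a) ≈ - ι a
  ι-neg a = inverseˡ-unique _ _ (trans (sym (ι-+ _ _)) (trans (reflexive (cong ι (CommutativeRing.-‿inverseˡ (FieldFacts.F-ring 𝔽) a))) ι-0))

  ι-^ : ∀ a n → ι (a ^F n) ≈ ι a ^ n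
  ι-^ a zero = ι-1
  ι-^ a (suc n) = trans (ι-* _ _) (*-congˡ (ι-^ a n))

  ι-× : ∀ n a → ι (n ×F a) ≈ n × ι a
  ι-× zero a = ι-0
  ι-× (suc n) a = trans (ι-+ _ _) (+-congˡ (ι-× n a))

  q×≈0 : ∀ x → q × x ≈ 0#
  q×≈0 x = begin
    q × x                ≈⟨ ×-congʳ q (*-identityˡ x) ⟨
    q × (1# * x)         ≈⟨ ×-assoc-* q 1# x ⟨
    (q × 1#) * x         ≈⟨ *-congʳ (×-congʳ q ι-1) ⟨
    (q × ι F.1#) * x     ≈⟨ *-congʳ (ι-× q F.1#) ⟨
    ι (q ×F F.1#) * x    ≈⟨ *-congʳ (trans (reflexive (cong ι q×1≡0)) ι-0) ⟩
    0# * x               ≈⟨ zeroˡ x ⟩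
    0#                   ∎

  ^q≈ : ∀ x → x ^ q ≈ x * x ^ q-1
  ^q≈ x = ^-congʳ x q≡

  -- The coefficient vector of `(X + Y)^q` was determined over F by Fermat's theorem and is
  -- evaluated here in `A`; no divisibility of binomial coefficients enters.
  ^q-+ : ∀ x y → (x + y) ^ q ≈ x ^ q + y ^ q
  ^q-+ x y = begin
    (x + y) ^ q                                     ≈⟨ ^-cong (+-congˡ (sym (trans (*-congʳ ι-1) (*-identityˡ y)))) q≡ ⟩
    (x + ι F.1# * y) ^ suc q-1                      ≈⟨ linearPower-form A F.1# (suc q-1) x y ⟩
    x ^ suc q-1 + y * form (linearPower F.1# (suc q-1)) x y
      ≈⟨ +-congˡ (*-congˡ (reflexive (cong (λ p → form p x y) linearPower-q))) ⟩
    x ^ suc q-1 + y * form (F.1# ∷ replicate q-1 F.0#) x y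
      ≈⟨ +-congˡ (*-congˡ (trans (form-Yⁿ q-1 F.1# x y) (trans (*-congʳ ι-1) (*-identityˡ _)))) ⟩
    x ^ suc q-1 + y ^ suc q-1                       ≈⟨ +-cong (^q≈ x) (^q≈ y) ⟨
    x ^ q + y ^ q                                   ∎

  ∑-linear-[q-1] : ∀ x y → (∑[ c ∈ elems ] (x + ι c * y) ^ q-1) ≈ - (y ^ q-1)
  ∑-linear-[q-1] x y = begin
    (∑[ c ∈ elems ] (x + ι c * y) ^ q-1)           ≈⟨ ∑-cong elems (λ c → linearPower-full A c q-1 x y) ⟨
    (∑[ c ∈ elems ] form (powers-[q-1] c) x y)     ≈⟨ sumVec-form A powers-[q-1] elems x y ⟨
    form (sumVec powers-[q-1] elems) x y           ≈⟨ reflexive (cong (λ p → form p x y) ∑-linearPowers) ⟩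
    form (F.- F.1# ∷ replicate q-1 F.0#) x y       ≈⟨ form-Yⁿ q-1 _ x y ⟩
    ι (F.- F.1#) * y ^ q-1                         ≈⟨ *-congʳ (trans (ι-neg _) (-‿cong ι-1)) ⟩
    - 1# * y ^ q-1                                 ≈⟨ solve 1 (λ u → :- (u :^ 0) :* u := :- u) refl _ ⟩
    - (y ^ q-1)                                    ∎

  0^q : 0# ^ q ≈ 0#
  0^q = trans (^q≈ 0#) (zeroˡ _)

  1^ : ∀ n → 1# ^ n ≈ 1#
  1^ zero = refl
  1^ (suc n) = trans (*-identityˡ _) (1^ n)

  Φ : ℕ → Carrier → Carrier
  Φ k x = x ^ (q ℕ.^ k)

  Φ-cong : ∀ k {x y} → x ≈ y → Φ k x ≈ Φ k y
  Φ-cong k = ^-congˡ (q ℕ.^ k)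

  Φ-zero : ∀ x → Φ 0 x ≈ x
  Φ-zero x = *-identityʳ x

  Φ-∘ : ∀ j k x → Φ j (Φ k x) ≈ Φ (k ℕ.+ j) x
  Φ-∘ j k x = trans (^-assocʳ x (q ℕ.^ k) (q ℕ.^ j)) (^-congʳ x (≡.sym (ℕₚ.^-distribˡ-+-* q k j)))

  Φ-suc : ∀ k x → Φ (suc k) x ≈ Φ k x ^ q
  Φ-suc k x = sym (trans (^-assocʳ x (q ℕ.^ k) q) (^-congʳ x (ℕₚ.*-comm (q ℕ.^ k) q)))

  Φ-1 : ∀ x → Φ 1 x ≈ x ^ q
  Φ-1 x = trans (Φ-suc 0 x) (^-congˡ q (Φ-zero x))

  Φ-+ : ∀ k x y → Φ k (x + y) ≈ Φ k x + Φ k y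
  Φ-+ zero x y = trans (Φ-zero _) (sym (+-cong (Φ-zero x) (Φ-zero y)))
  Φ-+ (suc k) x y = begin
    Φ (suc k) (x + y)            ≈⟨ Φ-suc k _ ⟩
    Φ k (x + y) ^ q              ≈⟨ ^-congˡ q (Φ-+ k x y) ⟩
    (Φ k x + Φ k y) ^ q          ≈⟨ ^q-+ _ _ ⟩
    Φ k x ^ q + Φ k y ^ q        ≈⟨ +-cong (Φ-suc k x) (Φ-suc k y) ⟨
    Φ (suc k) x + Φ (suc k) y    ∎

  Φ-* : ∀ k x y → Φ k (x * y) ≈ Φ k x * Φ k y
  Φ-* k x y = ^-distrib-* x y (q ℕ.^ k)

  Φ-0 : ∀ k → Φ k 0# ≈ 0#
  Φ-0 zero = Φ-zero 0#
  Φ-0 (suc k) = trans (Φ-suc k 0#) (trans (^-congˡ q (Φ-0 k)) 0^q)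

  Φ-neg : ∀ k x → Φ k (- x) ≈ - Φ k x
  Φ-neg k x = inverseˡ-unique _ _ (trans (sym (Φ-+ k (- x) x)) (trans (Φ-cong k (-‿inverseˡ x)) (Φ-0 k)))

  Φ-sub : ∀ k x y → Φ k (x + - y) ≈ Φ k x + - Φ k y
  Φ-sub k x y = trans (Φ-+ k x (- y)) (+-congˡ (Φ-neg k y))

  Φ-ι : ∀ k a → Φ k (ι a) ≈ ι a
  Φ-ι zero a = Φ-zero (ι a)
  Φ-ι (suc k) a = trans (Φ-suc k _) (trans (^-congˡ q (Φ-ι k a)) (trans (sym (ι-^ a q)) (reflexive (cong ι (fermat a)))))

  Φ-^ : ∀ k x n → Φ k (x ^ n) ≈ Φ k x ^ n
  Φ-^ k x n = trans (^-assocʳ x n (q ℕ.^ k)) (trans (^-congʳ x (ℕₚ.*-comm n (q ℕ.^ k))) (sym (^-assocʳ x (q ℕ.^ k) n)))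

  Φ-∑ : ∀ k {a} {B : Set a} (xs : List B) f → Φ k (∑ xs f) ≈ ∑ xs (λ x → Φ k (f x))
  Φ-∑ k [] f = Φ-0 k
  Φ-∑ k (x ∷ xs) f = trans (Φ-+ k _ _) (+-congˡ (Φ-∑ k xs f))

  Φ-unit : ∀ k {x y} → x * y ≈ 1# → Φ k x * Φ k y ≈ 1#
  Φ-unit k eq = trans (sym (Φ-* k _ _)) (trans (Φ-cong k eq) (1^ (q ℕ.^ k)))

  ^q-sub : ∀ x y → (x + - y) ^ q ≈ x ^ q + - y ^ q
  ^q-sub x y = trans (sym (Φ-1 _)) (trans (Φ-sub 1 x y) (+-cong (Φ-1 x) (-‿cong (Φ-1 y))))

  ^q-ι* : ∀ a x → (ι a * x) ^ q ≈ ι a * x ^ q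
  ^q-ι* a x = trans (^-distrib-* _ _ q) (*-congʳ (trans (sym (Φ-1 (ι a))) (Φ-ι 1 a)))

-- Sums over all polynomials of bounded degree.

module PolynomialSums {𝔽 : FiniteField} (A : FieldAlgebra 𝔽) where
  open FiniteField 𝔽 using (F; elems)
  open Thakur 𝔽 using (allVecs)
  open FieldAlgebra A using (ring; ι)
  open CommutativeRing ring hiding (ring; zero)
  open Frobenius A
  open RingKit ring using (module Solver)
  open Solver using (solve; _:+_; _:*_; _:=_)
  open import Relation.Binary.Reasoning.Setoid setoid
  open ListSums ring

  ∑-allVecs-∷ : ∀ d (f : Vec F (suc d) → Carrier) →
    ∑ (allVecs (suc d)) f ≈ (∑[ c ∈ elems ] ∑[ v ∈ allVecs d ] f (c ∷ v))
  ∑-allVecs-∷ d f = trans (∑-concatMap _ elems f) (∑-cong elems (λ c → ∑-map (c ∷_) (allVecs d) f))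

  -- `allVecs` branches on the constant term, whereas the induction for the partial fractions
  -- removes the coefficient of the highest power. Exchanging the two outer sums moves the split to
  -- the other end.
  ∑-allVecs-∷ʳ : ∀ d (f : Vec F (suc d) → Carrier) →
    ∑ (allVecs (suc d)) f ≈ (∑[ c ∈ elems ] ∑[ v ∈ allVecs d ] f (v ∷ʳ c))
  ∑-allVecs-∷ʳ zero f = ∑-allVecs-∷ 0 f
  ∑-allVecs-∷ʳ (suc d) f = begin
    ∑ (allVecs (suc (suc d))) f
      ≈⟨ ∑-allVecs-∷ (suc d) f ⟩
    (∑[ a ∈ elems ] ∑[ v ∈ allVecs (suc d) ] f (a ∷ v))
      ≈⟨ ∑-cong elems (λ a → ∑-allVecs-∷ʳ d (λ v → f (a ∷ v))) ⟩
    (∑[ a ∈ elems ] ∑[ c ∈ elems ] ∑[ v ∈ allVecs d ] f (a ∷ (v ∷ʳ c)))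
      ≈⟨ ∑-swap elems elems _ ⟩
    (∑[ c ∈ elems ] ∑[ a ∈ elems ] ∑[ v ∈ allVecs d ] f (a ∷ (v ∷ʳ c)))
      ≈⟨ ∑-cong elems (λ c → ∑-allVecs-∷ d (λ v → f (v ∷ʳ c))) ⟨
    (∑[ c ∈ elems ] ∑[ v ∈ allVecs (suc d) ] f (v ∷ʳ c)) ∎

  eval : ∀ {d} → Vec F d → Carrier → Carrier
  eval [] y = 0#
  eval (a ∷ v) y = ι a + y * eval v y

  eval-∷ʳ : ∀ {d} (v : Vec F d) c y → eval (v ∷ʳ c) y ≈ eval v y + ι c * y ^ d
  eval-∷ʳ [] c y = begin
    ι c + y * 0#      ≈⟨ +-cong (*-identityʳ _) (sym (zeroʳ y)) ⟨
    ι c * 1# + 0#     ≈⟨ +-comm _ _ ⟩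
    0# + ι c * 1#     ∎
  eval-∷ʳ {suc d} (a ∷ v) c y = trans (+-congˡ (*-congˡ (eval-∷ʳ v c y)))
    (solve 5 (λ a y u c w → a :+ y :* (u :+ c :* w) := (a :+ y :* u) :+ c :* (y :* w)) refl (ι a) y (eval v y) (ι c) (y ^ d))

  Φ-eval : ∀ k {d} (v : Vec F d) y → Φ k (eval v y) ≈ eval v (Φ k y)
  Φ-eval k [] y = Φ-0 k
  Φ-eval k (a ∷ v) y = trans (Φ-+ k _ _) (+-cong (Φ-ι k a) (trans (Φ-* k _ _) (*-congˡ (Φ-eval k v y))))

-- Carlitz polynomials and partial fractions.

module Carlitz {𝔽 : FiniteField} (A : FieldAlgebra 𝔽) where
  open FiniteField 𝔽 using (F; q; elems)
  open FieldFacts 𝔽 using (q-1)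
  open Thakur 𝔽 using (allVecs)
  open FieldAlgebra A using (ring; ι)
  open CommutativeRing ring hiding (ring; zero)
  open Frobenius A
  open PolynomialSums A
  open RingKit ring using (module Solver)
  open Solver using (solve; _:+_; _:*_; _:-_; :-_; _:=_; _:^_)
  open import Relation.Binary.Reasoning.Setoid setoid
  open ListSums ring

  [_]⟨_⟩ : ℕ → Carrier → Carrier
  [ k ]⟨ y ⟩ = Φ k y + - y

  module _ (t y : Carrier) ([_]⁻¹ : ℕ → Carrier) ([]-inverse : ∀ k → [ suc k ]⟨ y ⟩ * [ k ]⁻¹ ≈ 1#) where

    -- For y = θ: e d z is the product of z - a over all polynomials a of degree less than d, e′ d is its
    -- coefficient of z, and D d is the product of the monic polynomials of degree d.  Λ d is the F-linear
    -- polynomial with Λ d (yⁱ) = tⁱ for i < d.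
    D D⁻¹ e′ ℓ b : ℕ → Carrier
    D zero = 1#
    D (suc d) = [ suc d ]⟨ y ⟩ * D d ^ q
    D⁻¹ zero = 1#
    D⁻¹ (suc d) = [ d ]⁻¹ * D⁻¹ d ^ q
    e′ zero = 1#
    e′ (suc d) = - (D d ^ q-1) * e′ d
    ℓ zero = 1#
    ℓ (suc d) = ℓ d * (y + - Φ (suc d) y)
    b zero = 1#
    b (suc j) = b j * (t + - Φ j y)

    -- The recursion for `e` is the product over c in F of `e d z - c D d`, multiplied out as
    -- `X^q - Y^(q-1) X`. `ψ d` is Carlitz's normalised polynomial, with value 1 at `y^d`, and `Λ`
    -- is an interpolation in this basis with coefficients `b`.
    e ψ Λ : ℕ → Carrier → Carrier
    e zero z = z
    e (suc d) z = e d z ^ q + - (D d ^ q-1 * e d z)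
    ψ d z = D⁻¹ d * e d z
    Λ zero z = 0#
    Λ (suc d) z = Λ d z + b d * ψ d z

    D-inverse : ∀ d → D d * D⁻¹ d ≈ 1#
    D-inverse zero = *-identityˡ 1#
    D-inverse (suc d) = begin
      ([ suc d ]⟨ y ⟩ * D d ^ q) * ([ d ]⁻¹ * D⁻¹ d ^ q)
        ≈⟨ solve 4 (λ a b c d → (a :* b) :* (c :* d) := (a :* c) :* (b :* d)) refl _ _ _ _ ⟩
      ([ suc d ]⟨ y ⟩ * [ d ]⁻¹) * (D d ^ q * D⁻¹ d ^ q)   ≈⟨ *-cong ([]-inverse d) (sym (^-distrib-* _ _ q)) ⟩
      1# * (D d * D⁻¹ d) ^ q                               ≈⟨ trans (*-identityˡ _) (^-congˡ q (D-inverse d)) ⟩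
      1# ^ q                                               ≈⟨ 1^ q ⟩
      1#                                                   ∎

    -- `e′ d / D d` is the logarithmic derivative of `e d` at `y^d`, where `e d` takes the value
    -- `D d`; this identity rewrites it as `1 / ℓ d`.
    e′*ℓ≈D : ∀ d → e′ d * ℓ d ≈ D d
    e′*ℓ≈D zero = *-identityˡ 1#
    e′*ℓ≈D (suc d) = begin
      - (D d ^ q-1) * e′ d * (ℓ d * (y + - Φ (suc d) y))
        ≈⟨ solve 5 (λ u e l y z → :- u :* e :* (l :* (y :- z)) := (z :- y) :* ((e :* l) :* u)) refl _ _ _ _ _ ⟩
      [ suc d ]⟨ y ⟩ * (e′ d * ℓ d * D d ^ q-1)    ≈⟨ *-congˡ (trans (*-congʳ (e′*ℓ≈D d)) (sym (^q≈ (D d)))) ⟩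
      [ suc d ]⟨ y ⟩ * D d ^ q                      ∎

    e-linear : ∀ d z a u → e d (z + ι a * u) ≈ e d z + ι a * e d u
    e-linear zero z a u = refl
    e-linear (suc d) z a u = begin
      e d (z + ι a * u) ^ q + - (D d ^ q-1 * e d (z + ι a * u))
        ≈⟨ +-cong (^-congˡ q (e-linear d z a u)) (-‿cong (*-congˡ (e-linear d z a u))) ⟩
      (e d z + ι a * e d u) ^ q + - (D d ^ q-1 * (e d z + ι a * e d u))
        ≈⟨ +-congʳ (trans (^q-+ _ _) (+-congˡ (^q-ι* a _))) ⟩
      (e d z ^ q + ι a * e d u ^ q) + - (D d ^ q-1 * (e d z + ι a * e d u))
        ≈⟨ solve 6 (λ A a B D z u → (A :+ a :* B) :- D :* (z :+ a :* u) := (A :- D :* z) :+ a :* (B :- D :* u)) refl _ _ _ _ _ _ ⟩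
      e (suc d) z + ι a * e (suc d) u ∎

    Λ-linear : ∀ d z a u → Λ d (z + ι a * u) ≈ Λ d z + ι a * Λ d u
    Λ-linear zero z a u = sym (trans (+-identityˡ _) (zeroʳ _))
    Λ-linear (suc d) z a u = trans (+-cong (Λ-linear d z a u) (*-congˡ (*-congˡ (e-linear d z a u))))
      (solve 7 (λ A a B b D z u → (A :+ a :* B) :+ b :* (D :* (z :+ a :* u)) := (A :+ b :* (D :* z)) :+ a :* (B :+ b :* (D :* u)))
        refl _ _ _ _ _ _ _)

    -- Carlitz's functional equation, obtained by raising the previous case to the q-th power. The
    -- terms close up because `D (suc d) ^ q-1` times the bracket at `suc d` is the q-th power of
    -- that bracket times the q-th power of `D d ^ q-1`; this makes `e (suc d) z ^ q` reappear.
    e-shift : ∀ d z → e (suc d) (y * z) ≈ y * e (suc d) z + [ suc d ]⟨ y ⟩ * e d z ^ q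
    e-shift zero z = begin
      (y * z) ^ q + - (1# ^ q-1 * (y * z))
        ≈⟨ +-congʳ (^-distrib-* y z q) ⟩
      y ^ q * z ^ q + - (1# ^ q-1 * (y * z))
        ≈⟨ solve 5 (λ y z Y Z o → Y :* Z :- o :* (y :* z) := y :* (Z :- o :* z) :+ (Y :- y) :* Z) refl y z _ _ _ ⟩
      y * (z ^ q + - (1# ^ q-1 * z)) + (y ^ q + - y) * z ^ q
        ≈⟨ +-congˡ (*-congʳ (+-congʳ (sym (Φ-1 y)))) ⟩
      y * (z ^ q + - (1# ^ q-1 * z)) + (Φ 1 y + - y) * z ^ q ∎
    e-shift (suc d) z = begin
      e (suc d) (y * z) ^ q + - (Δ * e (suc d) (y * z))
        ≈⟨ +-cong (^-congˡ q (e-shift d z)) (-‿cong (*-congˡ (e-shift d z))) ⟩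
      (y * E + B * P) ^ q + - (Δ * (y * E + B * P))
        ≈⟨ +-congʳ (trans (^q-+ _ _) (+-cong (^-distrib-* _ _ q) (trans (^-distrib-* _ _ q) (*-congʳ B^q)))) ⟩
      (y ^ q * E ^ q + (Φ (2 ℕ.+ d) y + - y ^ q) * P ^ q) + - (Δ * (y * E + B * P))
        ≈⟨ solve 9 (λ yq y₂ y Δ B P Pq E Eq →
             (yq :* Eq :+ (y₂ :- yq) :* Pq) :- Δ :* (y :* E :+ B :* P)
             := (yq :* Eq :+ (y₂ :- yq) :* Pq) :- Δ :* (y :* E) :- (Δ :* B) :* P) refl _ _ y Δ B P _ E _ ⟩
      (y ^ q * E ^ q + (Φ (2 ℕ.+ d) y + - y ^ q) * P ^ q) + - (Δ * (y * E)) + - (Δ * B * P)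
        ≈⟨ +-congˡ (-‿cong (*-congʳ Δ*B)) ⟩
      (y ^ q * E ^ q + (Φ (2 ℕ.+ d) y + - y ^ q) * P ^ q) + - (Δ * (y * E)) + - ((Φ (2 ℕ.+ d) y + - y ^ q) * W * P)
        ≈⟨ solve 8 (λ yq y₂ y X P Pq W Eq →
             (yq :* Eq :+ (y₂ :- yq) :* Pq) :- X :- (y₂ :- yq) :* W :* P
             := (yq :* Eq :- X) :+ (y₂ :- yq) :* (Pq :- W :* P)) refl _ _ y (Δ * (y * E)) P _ W _ ⟩
      (y ^ q * E ^ q + - (Δ * (y * E))) + (Φ (2 ℕ.+ d) y + - y ^ q) * (P ^ q + - (W * P))
        ≈⟨ +-congˡ (*-congˡ E^q) ⟨
      (y ^ q * E ^ q + - (Δ * (y * E))) + (Φ (2 ℕ.+ d) y + - y ^ q) * E ^ q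
        ≈⟨ solve 6 (λ yq y₂ y Δ E Eq → (yq :* Eq :- Δ :* (y :* E)) :+ (y₂ :- yq) :* Eq := y :* (Eq :- Δ :* E) :+ (y₂ :- y) :* Eq)
             refl _ _ y Δ E _ ⟩
      y * (E ^ q + - (Δ * E)) + [ 2 ℕ.+ d ]⟨ y ⟩ * E ^ q ∎
      where
      E = e (suc d) z
      P = e d z ^ q
      B = [ suc d ]⟨ y ⟩
      Δ = D (suc d) ^ q-1
      W = (D d ^ q-1) ^ q
      B^q : B ^ q ≈ Φ (2 ℕ.+ d) y + - y ^ q
      B^q = trans (^q-sub _ _) (+-congʳ (sym (Φ-suc (suc d) y)))
      E^q : E ^ q ≈ P ^ q + - (W * P)
      E^q = trans (^q-sub _ _) (+-congˡ (-‿cong (^-distrib-* _ _ q)))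
      Δ*B : Δ * B ≈ (Φ (2 ℕ.+ d) y + - y ^ q) * W
      Δ*B = begin
        (B * D d ^ q) ^ q-1 * B               ≈⟨ *-congʳ (^-distrib-* _ _ q-1) ⟩
        B ^ q-1 * (D d ^ q) ^ q-1 * B         ≈⟨ solve 3 (λ a b c → a :* b :* c := (c :* a) :* b) refl _ _ _ ⟩
        B * B ^ q-1 * (D d ^ q) ^ q-1         ≈⟨ *-cong (trans (sym (^q≈ B)) B^q) exchange ⟩
        (Φ (2 ℕ.+ d) y + - y ^ q) * W         ∎
        where
        exchange : (D d ^ q) ^ q-1 ≈ W
        exchange = trans (^-assocʳ _ q q-1) (trans (^-congʳ _ (ℕₚ.*-comm q q-1)) (sym (^-assocʳ _ q-1 q)))

    -- Division of `e-shift` by `D (suc d)`. In the basis `ψ`, multiplication by `y` is bidiagonal,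
    -- which makes the sum in `Λ-shift` collapse.
    ψ-shift : ∀ d z → ψ (suc d) (y * z) ≈ Φ (suc d) y * ψ (suc d) z + ψ d z
    ψ-shift d z = begin
      D⁻¹ (suc d) * e (suc d) (y * z)
        ≈⟨ *-congˡ (e-shift d z) ⟩
      D⁻¹ (suc d) * (y * (E ^ q + - (N * E)) + (Φ (suc d) y + - y) * E ^ q)
        ≈⟨ solve 6 (λ I y Eq N E Y → I :* (y :* (Eq :- N :* E) :+ (Y :- y) :* Eq)
             := Y :* (I :* (Eq :- N :* E)) :+ (I :* ((Y :- y) :* N)) :* E) refl _ y _ N E _ ⟩
      Φ (suc d) y * ψ (suc d) z + (D⁻¹ (suc d) * ([ suc d ]⟨ y ⟩ * N)) * E
        ≈⟨ +-congˡ (*-congʳ drop) ⟩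
      Φ (suc d) y * ψ (suc d) z + ψ d z ∎
      where
      E = e d z
      N = D d ^ q-1
      drop : D⁻¹ (suc d) * ([ suc d ]⟨ y ⟩ * N) ≈ D⁻¹ d
      drop = begin
        D⁻¹ (suc d) * ([ suc d ]⟨ y ⟩ * N)                       ≈⟨ *-identityʳ _ ⟨
        D⁻¹ (suc d) * ([ suc d ]⟨ y ⟩ * N) * 1#                  ≈⟨ *-congˡ (D-inverse d) ⟨
        D⁻¹ (suc d) * ([ suc d ]⟨ y ⟩ * N) * (D d * D⁻¹ d)
          ≈⟨ solve 5 (λ I B N D J → I :* (B :* N) :* (D :* J) := ((B :* (D :* N)) :* I) :* J) refl _ _ _ _ _ ⟩
        ([ suc d ]⟨ y ⟩ * (D d * N)) * D⁻¹ (suc d) * D⁻¹ d       ≈⟨ *-congʳ (*-congʳ (*-congˡ (^q≈ (D d)))) ⟨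
        D (suc d) * D⁻¹ (suc d) * D⁻¹ d                          ≈⟨ *-congʳ (D-inverse (suc d)) ⟩
        1# * D⁻¹ d                                               ≈⟨ *-identityˡ _ ⟩
        D⁻¹ d                                                    ∎

    -- The factors of `b` are chosen for this: the term `b d * Φ d y * ψ d z` left over at one level
    -- and `b d * (t - Φ d y) * ψ d z` from the next add up to `t * b d * ψ d z`. So `Λ` turns
    -- multiplication by `y` into multiplication by `t`, up to one boundary term.
    Λ-shift : ∀ d z → Λ (suc d) (y * z) ≈ t * Λ d z + b d * (Φ d y * ψ d z)
    Λ-shift zero z = trans (+-cong (sym (zeroʳ t)) (*-congˡ (*-identityˡ _)))
      (+-congˡ (*-congˡ (*-cong (sym (Φ-zero y)) (sym (*-identityˡ z)))))
    Λ-shift (suc d) z = begin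
      Λ (suc d) (y * z) + b (suc d) * ψ (suc d) (y * z)
        ≈⟨ +-cong (Λ-shift d z) (*-congˡ (ψ-shift d z)) ⟩
      (t * Λ d z + b d * (Φ d y * ψ d z)) + b d * (t + - Φ d y) * (Φ (suc d) y * ψ (suc d) z + ψ d z)
        ≈⟨ solve 6 (λ t L b Y p w → (t :* L :+ b :* (Y :* p)) :+ b :* (t :- Y) :* (w :+ p)
             := t :* (L :+ b :* p) :+ (b :* (t :- Y)) :* w) refl t _ _ _ _ _ ⟩
      t * (Λ d z + b d * ψ d z) + b (suc d) * (Φ (suc d) y * ψ (suc d) z) ∎

    e[y^d]≈D : ∀ d → e d (y ^ d) ≈ D d
    e[1+d][y^d]≈0 : ∀ d → e (suc d) (y ^ d) ≈ 0#
    e[y^d]≈D zero = refl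
    e[y^d]≈D (suc d) = begin
      e (suc d) (y * y ^ d)                                        ≈⟨ e-shift d (y ^ d) ⟩
      y * e (suc d) (y ^ d) + [ suc d ]⟨ y ⟩ * e d (y ^ d) ^ q
        ≈⟨ +-cong (trans (*-congˡ (e[1+d][y^d]≈0 d)) (zeroʳ y)) (*-congˡ (^-congˡ q (e[y^d]≈D d))) ⟩
      0# + D (suc d)                                               ≈⟨ +-identityˡ _ ⟩
      D (suc d)                                                    ∎
    e[1+d][y^d]≈0 d = begin
      E ^ q + - (D d ^ q-1 * E)    ≈⟨ +-cong (trans (^-congˡ q (e[y^d]≈D d)) (^q≈ (D d))) (-‿cong (*-congˡ (e[y^d]≈D d))) ⟩
      D d * D d ^ q-1 + - (D d ^ q-1 * D d)  ≈⟨ +-congʳ (*-comm _ _) ⟩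
      D d ^ q-1 * D d + - (D d ^ q-1 * D d)  ≈⟨ -‿inverseʳ _ ⟩
      0#                           ∎
      where E = e d (y ^ d)

    Λ[1+d][y^d]≈t^d : ∀ d → Λ (suc d) (y ^ d) ≈ t ^ d
    Λ[1+d][y^d]≈t^d zero = trans (+-identityˡ _) (trans (*-identityˡ _) (*-identityˡ _))
    Λ[1+d][y^d]≈t^d (suc d) = begin
      Λ (2 ℕ.+ d) (y * y ^ d)                                                    ≈⟨ Λ-shift (suc d) (y ^ d) ⟩
      t * Λ (suc d) (y ^ d) + b (suc d) * (Φ (suc d) y * ψ (suc d) (y ^ d))
        ≈⟨ +-cong (*-congˡ (Λ[1+d][y^d]≈t^d d))
             (trans (*-congˡ (trans (*-congˡ (trans (*-congˡ (e[1+d][y^d]≈0 d)) (zeroʳ _))) (zeroʳ _))) (zeroʳ _)) ⟩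
      t * t ^ d + 0#                                                             ≈⟨ +-identityʳ _ ⟩
      t ^ suc d                                                                  ∎

    -- `Λ (suc d)` sends `y^d` to `t^d` and exceeds `Λ d` by `b d * ψ d`, whose last factor is 1 at
    -- `y^d`. Thus `b d` is the first failure of the interpolation.
    b≈ : ∀ d → t ^ d + - Λ d (y ^ d) ≈ b d
    b≈ d = begin
      t ^ d + - L                               ≈⟨ +-congʳ (Λ[1+d][y^d]≈t^d d) ⟨
      L + b d * (D⁻¹ d * e d (y ^ d)) + - L     ≈⟨ +-congʳ (+-congˡ (*-congˡ (trans (*-congˡ (e[y^d]≈D d)) (trans (*-comm _ _) (D-inverse d))))) ⟩
      L + b d * 1# + - L                        ≈⟨ solve 2 (λ L b → L :+ b :* (L :^ 0) :- L := b) refl L (b d) ⟩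
      b d                                       ∎
      where L = Λ d (y ^ d)

    -- Summing over the leading coefficient c of v, the factor G c below satisfies
    -- (X + cY) G c = e (suc d) z, and Σ_c G c = - Y^(q-1).
    ∑-partial-fractions : ∀ d z w (r : Vec F d → Carrier) → (∀ v → (z + eval v y) * r v ≈ 1#) →
      e d z * (∑[ v ∈ allVecs d ] (w + eval v t) * r v) ≈ e′ d * (w + - Λ d z)
    ∑-partial-fractions zero z w r unit = begin
      z * ((w + 0#) * r [] + 0#)      ≈⟨ *-congˡ (trans (+-identityʳ _) (*-congʳ (+-identityʳ w))) ⟩
      z * (w * r [])                  ≈⟨ solve 3 (λ z w r → z :* (w :* r) := w :* (z :* r)) refl _ _ _ ⟩
      w * (z * r [])                  ≈⟨ *-congˡ (trans (*-congʳ (sym (+-identityʳ z))) (unit [])) ⟩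
      w * 1#                          ≈⟨ *-comm _ _ ⟩
      1# * w                          ≈⟨ *-congˡ (trans (sym (+-identityʳ w)) (+-congˡ (sym -0≈0))) ⟩
      1# * (w + - 0#)                 ∎
      where
      -0≈0 : - 0# ≈ 0#
      -0≈0 = trans (sym (+-identityˡ _)) (-‿inverseʳ 0#)
    ∑-partial-fractions (suc d) z w r unit = begin
      E * (∑[ v ∈ allVecs (suc d) ] (w + eval v t) * r v)
        ≈⟨ *-congˡ (∑-allVecs-∷ʳ d _) ⟩
      E * (∑[ c ∈ elems ] ∑[ v ∈ allVecs d ] (w + eval (v ∷ʳ c) t) * r (v ∷ʳ c))
        ≈⟨ ∑-*ˡ elems E _ ⟩
      (∑[ c ∈ elems ] E * (∑[ v ∈ allVecs d ] (w + eval (v ∷ʳ c) t) * r (v ∷ʳ c)))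
        ≈⟨ ∑-cong elems (λ c → *-congˡ (∑-cong (allVecs d) (λ v → *-congʳ (regroup v c w t)))) ⟩
      (∑[ c ∈ elems ] E * inner c)
        ≈⟨ ∑-cong elems step ⟩
      (∑[ c ∈ elems ] e′ d * (a * G c + b d * (ι c * G c)))
        ≈⟨ ∑-*ˡ elems (e′ d) _ ⟨
      e′ d * (∑[ c ∈ elems ] a * G c + b d * (ι c * G c))
        ≈⟨ *-congˡ (trans (∑-+ elems _ _) (+-cong (sym (∑-*ˡ elems a _)) (sym (∑-*ˡ elems (b d) _)))) ⟩
      e′ d * (a * ∑ elems G + b d * (∑[ c ∈ elems ] ι c * G c))
        ≈⟨ *-congˡ (+-cong (*-congˡ ∑G) (*-congˡ ∑cG)) ⟩
      e′ d * (a * - (Y ^ q-1) + b d * (D⁻¹ d * (X * Y ^ q-1)))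
        ≈⟨ solve 7 (λ e w L N b I X → e :* ((w :- L) :* :- N :+ b :* (I :* (X :* N))) := :- N :* e :* (w :- (L :+ b :* (I :* X))))
             refl _ w _ _ _ _ _ ⟩
      e′ (suc d) * (w + - Λ (suc d) z) ∎
      where
      X = e d z
      Y = D d
      E = e (suc d) z
      a = w + - Λ d z
      G : F → Carrier
      G c = (X + ι c * Y) ^ q-1 + - (Y ^ q-1)
      inner : F → Carrier
      inner c = ∑[ v ∈ allVecs d ] ((w + ι c * t ^ d) + eval v t) * r (v ∷ʳ c)

      regroup : ∀ {d} (v : Vec F d) c w t → w + eval (v ∷ʳ c) t ≈ (w + ι c * t ^ d) + eval v t
      regroup v c w t = trans (+-congˡ (eval-∷ʳ v c t))
        (solve 3 (λ w u v → w :+ (u :+ v) := (w :+ v) :+ u) refl _ _ _)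

      G*[X+cY] : ∀ c → E ≈ G c * (X + ι c * Y)
      G*[X+cY] c = begin
        X ^ q + - (Y ^ q-1 * X)
          ≈⟨ solve 5 (λ X N Xq c YN → Xq :- N :* X := Xq :+ c :* YN :- N :* X :- c :* YN) refl X _ _ (ι c) (Y * Y ^ q-1) ⟩
        X ^ q + ι c * (Y * Y ^ q-1) + - (Y ^ q-1 * X) + - (ι c * (Y * Y ^ q-1))
          ≈⟨ +-congʳ (+-congʳ (+-congˡ (*-congˡ (^q≈ Y)))) ⟨
        X ^ q + ι c * Y ^ q + - (Y ^ q-1 * X) + - (ι c * (Y * Y ^ q-1))
          ≈⟨ +-congʳ (+-congʳ (trans (^q-+ _ _) (+-congˡ (^q-ι* c Y)))) ⟨
        (X + ι c * Y) ^ q + - (Y ^ q-1 * X) + - (ι c * (Y * Y ^ q-1))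
          ≈⟨ +-congʳ (+-congʳ (^q≈ (X + ι c * Y))) ⟩
        (X + ι c * Y) * (X + ι c * Y) ^ q-1 + - (Y ^ q-1 * X) + - (ι c * (Y * Y ^ q-1))
          ≈⟨ solve 5 (λ X c Y M N → (X :+ c :* Y) :* M :- N :* X :- c :* (Y :* N) := (M :- N) :* (X :+ c :* Y)) refl _ _ _ _ _ ⟩
        G c * (X + ι c * Y) ∎

      -- With the top coefficient c fixed, the sum has the shape of the previous degree with both
      -- base points moved: `z` by `c y^d` and `w` by `c t^d`.
      step : ∀ c → E * inner c ≈ e′ d * (a * G c + b d * (ι c * G c))
      step c = begin
        E * inner c
          ≈⟨ trans (*-congʳ (G*[X+cY] c)) (*-assoc _ _ _) ⟩
        G c * ((X + ι c * Y) * inner c)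
          ≈⟨ *-congˡ (*-congʳ (trans (e-linear d z c (y ^ d)) (+-congˡ (*-congˡ (e[y^d]≈D d))))) ⟨
        G c * (e d (z + ι c * y ^ d) * inner c)
          ≈⟨ *-congˡ (∑-partial-fractions d (z + ι c * y ^ d) (w + ι c * t ^ d) (λ v → r (v ∷ʳ c))
               (λ v → trans (*-congʳ (sym (regroup v c z y))) (unit (v ∷ʳ c)))) ⟩
        G c * (e′ d * ((w + ι c * t ^ d) + - Λ d (z + ι c * y ^ d)))
          ≈⟨ *-congˡ (*-congˡ (+-congˡ (-‿cong (Λ-linear d z c (y ^ d))))) ⟩
        G c * (e′ d * ((w + ι c * t ^ d) + - (Λ d z + ι c * Λ d (y ^ d))))
          ≈⟨ solve 7 (λ G e w c T L M → G :* (e :* ((w :+ c :* T) :- (L :+ c :* M))) := e :* ((w :- L) :* G :+ (T :- M) :* (c :* G)))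
               refl _ _ w _ _ _ _ ⟩
        e′ d * (a * G c + (t ^ d + - Λ d (y ^ d)) * (ι c * G c))
          ≈⟨ *-congˡ (+-congˡ (*-congʳ (b≈ d))) ⟩
        e′ d * (a * G c + b d * (ι c * G c)) ∎

      ∑G : ∑ elems G ≈ - (Y ^ q-1)
      ∑G = begin
        ∑ elems G                                                                     ≈⟨ ∑-+ elems _ _ ⟩
        (∑[ c ∈ elems ] (X + ι c * Y) ^ q-1) + (∑[ _ ∈ elems ] - (Y ^ q-1))          ≈⟨ +-cong (∑-linear-[q-1] X Y) (∑-const elems _) ⟩
        - (Y ^ q-1) + _                                                               ≈⟨ +-congˡ (q×≈0 _) ⟩
        - (Y ^ q-1) + 0#                                                              ≈⟨ +-identityʳ _ ⟩
        - (Y ^ q-1)                                                                   ∎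

      -- Summing `(X + cY) G c = E` over c gives q copies of `E`, that is 0; as `Y` is invertible,
      -- this determines the weighted sum from `∑G`.
      ∑cG : (∑[ c ∈ elems ] ι c * G c) ≈ D⁻¹ d * (X * Y ^ q-1)
      ∑cG = begin
        Σ                                   ≈⟨ *-identityˡ _ ⟨
        1# * Σ                              ≈⟨ *-congʳ (D-inverse d) ⟨
        Y * D⁻¹ d * Σ                       ≈⟨ solve 4 (λ Y I Σ T → Y :* I :* Σ := I :* (Y :* Σ :+ T :- T)) refl Y (D⁻¹ d) Σ (X * ∑ elems G) ⟩
        D⁻¹ d * (Y * Σ + X * ∑ elems G + - (X * ∑ elems G))
          ≈⟨ *-congˡ (+-cong total (-‿cong (*-congˡ ∑G))) ⟩
        D⁻¹ d * (0# + - (X * - (Y ^ q-1)))  ≈⟨ *-congˡ (+-identityˡ _) ⟩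
        D⁻¹ d * - (X * - (Y ^ q-1))         ≈⟨ solve 3 (λ I X N → I :* :- (X :* :- N) := I :* (X :* N)) refl _ _ _ ⟩
        D⁻¹ d * (X * Y ^ q-1)               ∎
        where
        Σ = ∑[ c ∈ elems ] ι c * G c
        total : Y * Σ + X * ∑ elems G ≈ 0#
        total = begin
          Y * Σ + X * ∑ elems G    ≈⟨ +-cong (∑-*ˡ elems Y _) (∑-*ˡ elems X G) ⟩
          (∑[ c ∈ elems ] Y * (ι c * G c)) + (∑[ c ∈ elems ] X * G c)   ≈⟨ ∑-+ elems _ _ ⟨
          (∑[ c ∈ elems ] Y * (ι c * G c) + X * G c)
            ≈⟨ ∑-cong elems (λ c → trans (solve 4 (λ Y c G X → Y :* (c :* G) :+ X :* G := G :* (X :+ c :* Y)) refl _ _ _ _) (sym (G*[X+cY] c))) ⟩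
          (∑[ _ ∈ elems ] E)       ≈⟨ ∑-const elems E ⟩
          _                        ≈⟨ q×≈0 E ⟩
          0#                       ∎

    module _ (d : ℕ) (r : Vec F d → Carrier) (unit : ∀ v → (y ^ d + eval v y) * r v ≈ 1#) where

      private
        ∑-monic : ∀ w → ℓ d * (∑[ v ∈ allVecs d ] (w + eval v t) * r v) ≈ w + - Λ d (y ^ d)
        ∑-monic w = begin
          ℓ d * Σ                                        ≈⟨ trans (*-congʳ (D-inverse d)) (*-identityˡ _) ⟨
          D d * D⁻¹ d * (ℓ d * Σ)                        ≈⟨ *-congʳ (*-congʳ (e[y^d]≈D d)) ⟨
          e d (y ^ d) * D⁻¹ d * (ℓ d * Σ)                ≈⟨ solve 4 (λ E I l Σ → E :* I :* (l :* Σ) := (I :* l) :* (E :* Σ)) refl _ _ _ _ ⟩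
          D⁻¹ d * ℓ d * (e d (y ^ d) * Σ)                ≈⟨ *-congˡ (∑-partial-fractions d (y ^ d) w r unit) ⟩
          D⁻¹ d * ℓ d * (e′ d * W)                       ≈⟨ solve 4 (λ I l e w → I :* l :* (e :* w) := (e :* l) :* I :* w) refl _ _ _ _ ⟩
          e′ d * ℓ d * D⁻¹ d * W                         ≈⟨ *-congʳ (trans (*-congʳ (e′*ℓ≈D d)) (D-inverse d)) ⟩
          1# * W                                         ≈⟨ *-identityˡ _ ⟩
          W                                              ∎
          where
          Σ = ∑[ v ∈ allVecs d ] (w + eval v t) * r v
          W = w + - Λ d (y ^ d)

      ∑-monic-inverses : ℓ d * (∑[ v ∈ allVecs d ] r v) ≈ 1#
      ∑-monic-inverses = begin
        -- Only sums with a numerator `w + eval v t` are known, so the plain sum is obtained as the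
        -- case `w = 1` minus the case `w = 0`.
        ℓ d * ∑ (allVecs d) r
          ≈⟨ solve 3 (λ l r T → l :* r := l :* (r :+ T) :- l :* T) refl _ _ T ⟩
        ℓ d * (∑ (allVecs d) r + T) + - (ℓ d * T)
          ≈⟨ +-congʳ (*-congˡ (trans (sym (∑-+ (allVecs d) _ _))
               (∑-cong (allVecs d) (λ v → solve 2 (λ u r → r :+ u :* r := (u :^ 0 :+ u) :* r) refl _ _)))) ⟩
        ℓ d * (∑[ v ∈ allVecs d ] (1# + eval v t) * r v) + - (ℓ d * T)
          ≈⟨ +-cong (∑-monic 1#) (-‿cong (trans (*-congˡ (∑-cong (allVecs d) (λ v → *-congʳ (sym (+-identityˡ _))))) (∑-monic 0#))) ⟩
        (1# + - L) + - (0# + - L)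
          ≈⟨ +-congˡ (-‿cong (+-identityˡ _)) ⟩
        (1# + - L) + - - L
          ≈⟨ solve 1 (λ L → (L :^ 0 :- L) :- (:- L) := L :^ 0) refl L ⟩
        1# ∎
        where
        T = ∑[ v ∈ allVecs d ] eval v t * r v
        L = Λ d (y ^ d)

      ∑-monic-ratios : ℓ d * (∑[ v ∈ allVecs d ] (t ^ d + eval v t) * r v) ≈ b d
      ∑-monic-ratios = trans (∑-monic (t ^ d)) (b≈ d)

-- Truncated multizeta sums: closed forms and telescoping.

module Exponents (𝔽 : FiniteField) where
  open FiniteField 𝔽 using (q)

  -- The exponents `(q - 1) q^j` for j < n, built so that the tail is q times a shorter list: `Z-Φ`
  -- then makes the inner sum a q-th power and allows an induction on n. The head is written
  -- `q ^ 1 ∸ 1` to match `S-q^k-1`.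
  digits : ℕ → List ℕ
  digits zero = []
  digits (suc n) = (q ℕ.^ 1 ∸ 1) ∷ List.map (ℕ._* q ℕ.^ 1) (digits n)

  inner : ℕ → List ℕ
  inner n = (q ℕ.^ 2 ∸ 1) ∷ List.map (ℕ._* q ℕ.^ 2) (digits n)

-- Keeping these inverses as data separates the algebra of the truncated sums from the construction
-- of Laurent series and from convergence.
record InvertibleMonics {𝔽 : FiniteField} (A : FieldAlgebra 𝔽) : Set where
  open FiniteField 𝔽 using (F)
  open CommutativeRing (FieldAlgebra.ring A)
  open Frobenius A
  open PolynomialSums A
  -- [ k ]⁻¹ is the inverse of the bracket [k + 1].
  field
    θ : Carrier
    [_]⁻¹ : ℕ → Carrier
    []-inverse : ∀ k → (Φ (suc k) θ + - θ) * [ k ]⁻¹ ≈ 1#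
    r : ∀ d → Vec F d → Carrier
    r-inverse : ∀ d v → (θ ^ d + eval v θ) * r d v ≈ 1#

module Multizeta {𝔽 : FiniteField} (A : FieldAlgebra 𝔽) (M : InvertibleMonics A) where
  open FiniteField 𝔽 using (q)
  open CommutativeRing (FieldAlgebra.ring A)
  open Frobenius A
  open PolynomialSums A
  open InvertibleMonics M
  open Exponents 𝔽
  open Thakur 𝔽 using (allVecs)
  open FieldFacts 𝔽 using (q≡)
  open Carlitz A using (∑-monic-inverses; ∑-monic-ratios)
  open RingKit (FieldAlgebra.ring A) using (module Solver)
  open Solver using (solve; _:+_; _:*_; _:-_; :-_; _:=_; _:^_)
  open import Relation.Binary.Reasoning.Setoid setoid
  open ListSums (FieldAlgebra.ring A)

  ∑< ∏< : ℕ → (ℕ → Carrier) → Carrier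
  ∑< zero f = 0#
  ∑< (suc n) f = ∑< n f + f n
  ∏< zero f = 1#
  ∏< (suc n) f = ∏< n f * f n

  S : ℕ → ℕ → Carrier
  S d s = ∑[ v ∈ allVecs d ] r d v ^ s

  Z : List ℕ → ℕ → Carrier
  Z [] D = 1#
  Z (s ∷ ss) D = ∑< D (λ d → S d s * Z ss d)

  S-Φ : ∀ k d s → S d (s ℕ.* q ℕ.^ k) ≈ Φ k (S d s)
  S-Φ k d s = trans (∑-cong (allVecs d) (λ v → sym (^-assocʳ (r d v) s (q ℕ.^ k)))) (sym (Φ-∑ k (allVecs d) _))

  ∑<-cong : ∀ D {f f′ : ℕ → Carrier} → (∀ d → f d ≈ f′ d) → ∑< D f ≈ ∑< D f′
  ∑<-cong zero eq = refl
  ∑<-cong (suc D) eq = +-cong (∑<-cong D eq) (eq D)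

  Φ-∑< : ∀ k D f → Φ k (∑< D f) ≈ ∑< D (λ d → Φ k (f d))
  Φ-∑< k zero f = Φ-0 k
  Φ-∑< k (suc D) f = trans (Φ-+ k _ _) (+-congʳ (Φ-∑< k D f))

  Z-Φ : ∀ k ss D → Z (List.map (ℕ._* q ℕ.^ k) ss) D ≈ Φ k (Z ss D)
  Z-Φ k [] D = sym (1^ (q ℕ.^ k))
  Z-Φ k (s ∷ ss) D = trans
    (∑<-cong D (λ d → trans (*-cong (S-Φ k d s) (Z-Φ k ss d)) (sym (Φ-* k _ _))))
    (sym (Φ-∑< k D _))

  -- In Carlitz's notation g k = -[k] and L d = ℓ_d; g⁻¹ k is the inverse of g (k + 1).
  g g⁻¹ L L⁻¹ : ℕ → Carrier
  g k = θ + - Φ k θ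
  g⁻¹ k = - [ k ]⁻¹
  L zero = 1#
  L (suc d) = L d * g (suc d)
  L⁻¹ zero = 1#
  L⁻¹ (suc d) = L⁻¹ d * g⁻¹ d

  g-inverse : ∀ k → g (suc k) * g⁻¹ k ≈ 1#
  g-inverse k = trans (solve 3 (λ x y i → (x :- y) :* (:- i) := (y :- x) :* i) refl _ _ _) ([]-inverse k)

  L-inverse : ∀ d → L d * L⁻¹ d ≈ 1#
  L-inverse zero = *-identityˡ 1#
  L-inverse (suc d) = trans (solve 4 (λ a b c d → (a :* b) :* (c :* d) := (a :* c) :* (b :* d)) refl _ _ _ _)
    (trans (*-cong (L-inverse d) (g-inverse d)) (*-identityˡ 1#))

  unit-solve : ∀ {u v x y} → u * v ≈ 1# → u * x ≈ y → x ≈ v * y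
  unit-solve {u} {v} {x} {y} uv≈1 ux≈y = begin
    x             ≈⟨ *-identityˡ x ⟨
    1# * x        ≈⟨ *-congʳ uv≈1 ⟨
    u * v * x     ≈⟨ solve 3 (λ u v x → u :* v :* x := v :* (u :* x)) refl u v x ⟩
    v * (u * x)   ≈⟨ *-congˡ ux≈y ⟩
    v * y         ∎

  S-1 : ∀ d → S d 1 ≈ L⁻¹ d
  S-1 d = begin
    S d 1                       ≈⟨ ∑-cong (allVecs d) (λ v → *-identityʳ _) ⟩
    ∑ (allVecs d) (r d)         ≈⟨ unit-solve (L-inverse d) (trans (*-congʳ (sym (ℓ≈L d))) (∑-monic-inverses θ θ [_]⁻¹ []-inverse d (r d) (r-inverse d))) ⟩
    L⁻¹ d * 1#                  ≈⟨ *-identityʳ _ ⟩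
    L⁻¹ d                       ∎
    where
    ℓ≈L : ∀ d → Carlitz.ℓ A θ θ [_]⁻¹ []-inverse d ≈ L d
    ℓ≈L zero = refl
    ℓ≈L (suc d) = *-congʳ (ℓ≈L d)

  -- The numerator `∏ (t - y^(q^i))` of the partial fractions at `t = θ`, `y = θ^(q^k)`. For k = 1
  -- it is `L d`, and for k = 2 it is `L (suc d)` without its first factor; the tuple involves just
  -- these two cases.
  B : ℕ → ℕ → Carrier
  B k zero = 1#
  B k (suc d) = B k d * g (k ℕ.+ d)

  S-q^k-1 : ∀ k d → S d (q ℕ.^ k ∸ 1) ≈ Φ k (L⁻¹ d) * B k d
  S-q^k-1 k d = begin
    S d (q ℕ.^ k ∸ 1)           ≈⟨ ∑-cong (allVecs d) (λ v → power v) ⟩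
    (∑[ v ∈ allVecs d ] (θ ^ d + eval v θ) * Φ k (r d v))
      ≈⟨ unit-solve (Φ-unit k (L-inverse d)) (trans (*-congʳ (sym (ℓ≈ d))) (∑-monic-ratios θ (Φ k θ) inv inv-inverse d
           (λ v → Φ k (r d v)) (λ v → trans (*-congʳ (conj v)) (Φ-unit k (r-inverse d v))))) ⟩
    Φ k (L⁻¹ d) * Carlitz.b A θ (Φ k θ) inv inv-inverse d   ≈⟨ *-congˡ (b≈B d) ⟩
    Φ k (L⁻¹ d) * B k d         ∎
    where
    instance
      q≢0 : NonZero q
      q≢0 rewrite q≡ = _
    -- The brackets of `θ^(q^k)` are the `q^k`-th powers of those of `θ`, hence so are their
    -- inverses.
    inv : ℕ → Carrier
    inv j = Φ k [ j ]⁻¹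
    conjugate : ∀ j → Φ j (Φ k θ) ≈ Φ k (Φ j θ)
    conjugate j = Φ-^ j θ (q ℕ.^ k)
    inv-inverse : ∀ j → (Φ (suc j) (Φ k θ) + - Φ k θ) * inv j ≈ 1#
    inv-inverse j = trans (*-congʳ (trans (+-congʳ (conjugate (suc j))) (sym (Φ-sub k _ _)))) (Φ-unit k ([]-inverse j))
    conj : ∀ v → Φ k θ ^ d + eval v (Φ k θ) ≈ Φ k (θ ^ d + eval v θ)
    conj v = sym (trans (Φ-+ k _ _) (+-cong (Φ-^ k θ d) (Φ-eval k v θ)))
    ℓ≈ : ∀ d → Carlitz.ℓ A θ (Φ k θ) inv inv-inverse d ≈ Φ k (L d)
    ℓ≈ zero = sym (1^ (q ℕ.^ k))
    ℓ≈ (suc d) = sym (trans (Φ-* k _ _) (*-cong (sym (ℓ≈ d)) (trans (Φ-sub k _ _) (+-congˡ (-‿cong (sym (conjugate (suc d))))))))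
    b≈B : ∀ d → Carlitz.b A θ (Φ k θ) inv inv-inverse d ≈ B k d
    b≈B zero = refl
    b≈B (suc d) = *-cong (b≈B d) (+-congˡ (-‿cong (Φ-∘ d k θ)))
    power : ∀ v → r d v ^ (q ℕ.^ k ∸ 1) ≈ (θ ^ d + eval v θ) * Φ k (r d v)
    power v = begin
      r d v ^ (q ℕ.^ k ∸ 1)                                    ≈⟨ *-identityˡ _ ⟨
      1# * r d v ^ (q ℕ.^ k ∸ 1)                               ≈⟨ *-congʳ (r-inverse d v) ⟨
      (θ ^ d + eval v θ) * r d v * r d v ^ (q ℕ.^ k ∸ 1)       ≈⟨ *-assoc _ _ _ ⟩
      (θ ^ d + eval v θ) * r d v ^ suc (q ℕ.^ k ∸ 1)           ≈⟨ *-congˡ (^-congʳ (r d v) (ℕₚ.suc-pred (q ℕ.^ k) ⦃ ℕₚ.m^n≢0 q k ⦄)) ⟩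
      (θ ^ d + eval v θ) * Φ k (r d v)                         ∎

  B-1 : ∀ d → B 1 d ≈ L d
  B-1 zero = refl
  B-1 (suc d) = *-congʳ (B-1 d)

  B-2 : ∀ d → B 2 d ≈ g⁻¹ 0 * L (suc d)
  B-2 zero = sym (trans (solve 3 (λ i o g → i :* (o :* g) := o :* (g :* i)) refl _ _ _) (trans (*-identityˡ _) (g-inverse 0)))
  B-2 (suc d) = trans (*-congʳ (B-2 d)) (*-assoc _ _ _)

  -- L⁻¹ₛ d m is L⁻¹ (d - m), and 0 when d < m.
  L⁻¹ₛ : ℕ → ℕ → Carrier
  L⁻¹ₛ d zero = L⁻¹ d
  L⁻¹ₛ zero (suc m) = 0#
  L⁻¹ₛ (suc d) (suc m) = L⁻¹ₛ d m

  -- With `Q = q^m`, the difference `g (suc d) - g m = θ^Q - θ^(q^(d+1))` is the Q-th power of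
  -- `g (d + 1 - m)`, the factor by which consecutive shifted inverses differ. For `d < m` the
  -- convention of value 0 keeps the identity true.
  g*L⁻¹ₛ : ∀ d m → g (suc d) * Φ m (L⁻¹ₛ (suc d) m) ≈ g m * Φ m (L⁻¹ₛ (suc d) m) + Φ m (L⁻¹ₛ d m)
  g*L⁻¹ₛ d zero = begin
    g (suc d) * Φ 0 X                       ≈⟨ *-congˡ (Φ-zero X) ⟩
    g (suc d) * (L⁻¹ d * g⁻¹ d)             ≈⟨ solve 3 (λ g l i → g :* (l :* i) := (g :* i) :* l) refl _ _ _ ⟩
    g (suc d) * g⁻¹ d * L⁻¹ d               ≈⟨ trans (*-congʳ (g-inverse d)) (*-identityˡ _) ⟩
    L⁻¹ d                                   ≈⟨ trans (+-congʳ (trans (*-congʳ (-‿inverseʳ θ)) (zeroˡ _))) (+-identityˡ _) ⟨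
    (θ + - θ) * Φ 0 X + L⁻¹ d               ≈⟨ +-cong (*-congʳ (+-congˡ (-‿cong (Φ-zero θ)))) (Φ-zero _) ⟨
    g 0 * Φ 0 X + Φ 0 (L⁻¹ d)               ∎
    where X = L⁻¹ d * g⁻¹ d
  g*L⁻¹ₛ zero (suc zero) = sym (trans (+-congˡ (Φ-0 1)) (+-identityʳ _))
  g*L⁻¹ₛ zero (suc (suc m)) = trans (vanish (g 1)) (sym (trans (+-cong (vanish (g (2 ℕ.+ m))) (Φ-0 (2 ℕ.+ m))) (+-identityˡ _)))
    where
    vanish : ∀ x → x * Φ (2 ℕ.+ m) 0# ≈ 0#
    vanish x = trans (*-congˡ (Φ-0 (2 ℕ.+ m))) (zeroʳ x)
  g*L⁻¹ₛ (suc d) (suc m) = begin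
    -- Raising the previous case to the q-th power replaces the leading `θ` in both factors `g` by
    -- `θ^q`; adding `(θ - θ^q) P` to both sides restores it.
    g (2 ℕ.+ d) * P
      ≈⟨ solve 4 (λ θ u v P → (θ :- v) :* P := (u :- v) :* P :+ (θ :- u) :* P) refl θ (Φ 1 θ) _ P ⟩
    (Φ 1 θ + - Φ (2 ℕ.+ d) θ) * P + (θ + - Φ 1 θ) * P
      ≈⟨ +-congʳ induction ⟩
    ((Φ 1 θ + - Φ (suc m) θ) * P + Φ (suc m) (L⁻¹ₛ d m)) + (θ + - Φ 1 θ) * P
      ≈⟨ solve 5 (λ θ u v P w → ((u :- v) :* P :+ w) :+ (θ :- u) :* P := (θ :- v) :* P :+ w) refl θ (Φ 1 θ) _ P _ ⟩
    g (suc m) * P + Φ (suc m) (L⁻¹ₛ d m) ∎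
    where
    P = Φ (suc m) (L⁻¹ₛ (suc d) m)
    Φ-1-∘ : ∀ x → Φ 1 (Φ m x) ≈ Φ (suc m) x
    Φ-1-∘ x = trans (Φ-1 _) (sym (Φ-suc m x))
    Φ-1-g : ∀ j → Φ 1 (g j) ≈ Φ 1 θ + - Φ (suc j) θ
    Φ-1-g j = trans (Φ-sub 1 _ _) (+-congˡ (-‿cong (trans (Φ-1 _) (sym (Φ-suc j θ)))))
    induction : (Φ 1 θ + - Φ (2 ℕ.+ d) θ) * P ≈ (Φ 1 θ + - Φ (suc m) θ) * P + Φ (suc m) (L⁻¹ₛ d m)
    induction = begin
      (Φ 1 θ + - Φ (2 ℕ.+ d) θ) * P                       ≈⟨ *-cong (Φ-1-g (suc d)) (Φ-1-∘ _) ⟨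
      Φ 1 (g (suc d)) * Φ 1 (Φ m (L⁻¹ₛ (suc d) m))        ≈⟨ Φ-* 1 _ _ ⟨
      Φ 1 (g (suc d) * Φ m (L⁻¹ₛ (suc d) m))              ≈⟨ Φ-cong 1 (g*L⁻¹ₛ d m) ⟩
      Φ 1 (g m * Φ m (L⁻¹ₛ (suc d) m) + Φ m (L⁻¹ₛ d m))   ≈⟨ trans (Φ-+ 1 _ _) (+-cong (Φ-* 1 _ _) (Φ-1-∘ _)) ⟩
      Φ 1 (g m) * Φ 1 (Φ m (L⁻¹ₛ (suc d) m)) + Φ (suc m) (L⁻¹ₛ d m)
                                                          ≈⟨ +-congʳ (*-cong (Φ-1-g m) (Φ-1-∘ _)) ⟩
      (Φ 1 θ + - Φ (suc m) θ) * P + Φ (suc m) (L⁻¹ₛ d m)  ∎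

  -- T m telescopes the summands of Z (digits m) and Z (inner n), by T-suc.
  T : ℕ → ℕ → Carrier
  T m d = L d * Φ m (L⁻¹ₛ d m)

  T-suc : ∀ m d → T m (suc d) ≈ T m d + g m * (L d * Φ m (L⁻¹ₛ (suc d) m))
  T-suc m d = begin
    L d * g (suc d) * Φ m (L⁻¹ₛ (suc d) m)                        ≈⟨ *-assoc _ _ _ ⟩
    L d * (g (suc d) * Φ m (L⁻¹ₛ (suc d) m))                      ≈⟨ *-congˡ (g*L⁻¹ₛ d m) ⟩
    L d * (g m * Φ m (L⁻¹ₛ (suc d) m) + Φ m (L⁻¹ₛ d m))           ≈⟨ solve 4 (λ l g x y → l :* (g :* x :+ y) := l :* y :+ g :* (l :* x)) refl _ _ _ _ ⟩
    T m d + g m * (L d * Φ m (L⁻¹ₛ (suc d) m))                    ∎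

  T-zero : ∀ m → T (suc m) 0 ≈ 0#
  T-zero m = trans (*-congˡ (Φ-0 (suc m))) (zeroʳ _)

  -- The product of `g j ^ (-q^(m-j))` over `1 ≤ j ≤ m`. Each further entry of the tuple raises the
  -- earlier constant to the q-th power and adds one inverse from the telescoping.
  κ : ℕ → Carrier
  κ zero = 1#
  κ (suc m) = Φ 1 (κ m) * g⁻¹ m

  -- `S d (q - 1)` is `L d` divided by its q-th power, and the q-th power of `T m d` contributes
  -- that same q-th power as a factor. After cancellation the summand is `κ (suc m)` times the
  -- increment of `T (suc m)` in `T-suc`.
  Z-digits : ∀ m d → Z (digits m) d ≈ κ m * T m d
  Z-digits zero d = sym (trans (*-identityˡ _) (trans (*-congˡ (Φ-zero _)) (L-inverse d)))
  Z-digits (suc m) zero = sym (trans (*-congˡ (T-zero m)) (zeroʳ _))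
  Z-digits (suc m) (suc d) = begin
    Z (digits (suc m)) d + S d (q ℕ.^ 1 ∸ 1) * Z (List.map (ℕ._* q ℕ.^ 1) (digits m)) d
      ≈⟨ +-cong (Z-digits (suc m) d) (*-cong (trans (S-q^k-1 1 d) (*-congˡ (B-1 d))) (trans (Z-Φ 1 (digits m) d) (Φ-cong 1 (Z-digits m d)))) ⟩
    κ (suc m) * T (suc m) d + Φ 1 (L⁻¹ d) * L d * Φ 1 (κ m * (L d * Φ m (L⁻¹ₛ d m)))
      ≈⟨ +-congˡ (*-congˡ (trans (Φ-* 1 _ _) (*-congˡ (trans (Φ-* 1 _ _) (*-congˡ (trans (Φ-1 _) (sym (Φ-suc m _)))))))) ⟩
    κ (suc m) * T (suc m) d + Φ 1 (L⁻¹ d) * L d * (Φ 1 (κ m) * (Φ 1 (L d) * X))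
      ≈⟨ +-congˡ (solve 5 (λ I l k M X → I :* l :* (k :* (M :* X)) := (M :* I) :* (k :* (l :* X))) refl _ _ _ _ _) ⟩
    κ (suc m) * T (suc m) d + Φ 1 (L d) * Φ 1 (L⁻¹ d) * (Φ 1 (κ m) * (L d * X))
      ≈⟨ +-congˡ (*-congʳ (trans (Φ-unit 1 (L-inverse d)) (sym (g-inverse m)))) ⟩
    κ (suc m) * T (suc m) d + g (suc m) * g⁻¹ m * (Φ 1 (κ m) * (L d * X))
      ≈⟨ solve 6 (λ k i T g l X → (k :* i) :* T :+ g :* i :* (k :* (l :* X)) := (k :* i) :* (T :+ g :* (l :* X))) refl _ _ _ _ _ _ ⟩
    κ (suc m) * (T (suc m) d + g (suc m) * (L d * X))
      ≈⟨ *-congˡ (T-suc (suc m) d) ⟨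
    κ (suc m) * T (suc m) (suc d) ∎
    where X = Φ (suc m) (L⁻¹ₛ d m)

  -- `Φ 2 (κ n)` comes from the tail, which is q² times `digits n`; `g⁻¹ 0` comes from `B-2`; and
  -- `g⁻¹ (suc n)`, the inverse of `g (2 + n)`, from the telescoping of `T (2 + n)`.
  C : ℕ → Carrier
  C n = Φ 2 (κ n) * (g⁻¹ 0 * g⁻¹ (suc n))

  -- The cancellation is that of `Z-digits`, but `B 2 d` contributes `L (suc d)` in place of `L d`.
  -- This moves the telescoping one step on, so `T` is taken at `suc d`; its initial value
  -- `T (2 + n) 1` still vanishes.
  Z-inner : ∀ n d → Z (inner n) d ≈ C n * T (2 ℕ.+ n) (suc d)
  Z-inner n zero = sym (trans (*-congˡ (trans (*-congˡ (Φ-0 (2 ℕ.+ n))) (zeroʳ _))) (zeroʳ _))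
  Z-inner n (suc d) = begin
    Z (inner n) d + S d (q ℕ.^ 2 ∸ 1) * Z (List.map (ℕ._* q ℕ.^ 2) (digits n)) d
      ≈⟨ +-cong (Z-inner n d) (*-cong (trans (S-q^k-1 2 d) (*-congˡ (B-2 d))) (trans (Z-Φ 2 (digits n) d) (Φ-cong 2 (Z-digits n d)))) ⟩
    C n * T m (suc d) + Φ 2 (L⁻¹ d) * (g⁻¹ 0 * L (suc d)) * Φ 2 (κ n * (L d * Φ n (L⁻¹ₛ d n)))
      ≈⟨ +-congˡ (*-congˡ (trans (Φ-* 2 _ _) (*-congˡ (trans (Φ-* 2 _ _) (*-congˡ Φ²))))) ⟩
    C n * T m (suc d) + Φ 2 (L⁻¹ d) * (g⁻¹ 0 * L (suc d)) * (Φ 2 (κ n) * (Φ 2 (L d) * X))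
      ≈⟨ +-congˡ (solve 6 (λ I i l k M X → I :* (i :* l) :* (k :* (M :* X)) := (M :* I) :* (k :* (i :* (l :* X)))) refl _ _ _ _ _ _) ⟩
    C n * T m (suc d) + Φ 2 (L d) * Φ 2 (L⁻¹ d) * (Φ 2 (κ n) * (g⁻¹ 0 * (L (suc d) * X)))
      ≈⟨ +-congˡ (*-congʳ (trans (Φ-unit 2 (L-inverse d)) (sym (g-inverse (suc n))))) ⟩
    C n * T m (suc d) + g m * g⁻¹ (suc n) * (Φ 2 (κ n) * (g⁻¹ 0 * (L (suc d) * X)))
      ≈⟨ solve 7 (λ k i j T g l X → (k :* (i :* j)) :* T :+ g :* j :* (k :* (i :* (l :* X))) := (k :* (i :* j)) :* (T :+ g :* (l :* X)))
           refl _ _ _ _ _ _ _ ⟩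
    C n * (T m (suc d) + g m * (L (suc d) * X))
      ≈⟨ *-congˡ (T-suc m (suc d)) ⟨
    C n * T m (suc (suc d)) ∎
    where
    m = 2 ℕ.+ n
    X = Φ m (L⁻¹ₛ d n)
    Φ² : Φ 2 (Φ n (L⁻¹ₛ d n)) ≈ X
    Φ² = trans (Φ-∘ 2 n _) (reflexive (cong (λ k → Φ k (L⁻¹ₛ d n)) (ℕₚ.+-comm n 2)))

  -- Terms with `d < m` vanish and the others are the power sums `S (d - m) (q^m)`, so this is the
  -- truncated zeta sum with its index shifted by m.
  U : ℕ → ℕ → Carrier
  U m D = ∑< D (λ d → Φ m (L⁻¹ₛ d m))

  -- `S D 1` is `1 / L D` and cancels the factor `L D` of `T m (suc D)`. What remains, `g (suc D)`
  -- times a shifted inverse, is split once more by `g*L⁻¹ₛ` into terms with neighbouring indices,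
  -- hence the lengths `suc D` and `D`.
  Z-tuple : ∀ n D → Z (1 ∷ inner n) D ≈ C n * (g (2 ℕ.+ n) * U (2 ℕ.+ n) (suc D) + U (2 ℕ.+ n) D)
  Z-tuple n zero = sym (begin
    C n * (g m * (0# + Φ m 0#) + 0#)   ≈⟨ *-congˡ (trans (+-identityʳ _) (*-congˡ (trans (+-identityˡ _) (Φ-0 m)))) ⟩
    C n * (g m * 0#)                   ≈⟨ trans (*-congˡ (zeroʳ _)) (zeroʳ _) ⟩
    0#                                 ∎)
    where m = 2 ℕ.+ n
  Z-tuple n (suc D) = begin
    Z (1 ∷ inner n) D + S D 1 * Z (inner n) D
      ≈⟨ +-cong (Z-tuple n D) (*-cong (S-1 D) (Z-inner n D)) ⟩
    C n * (g m * U m (suc D) + U m D) + L⁻¹ D * (C n * (L D * g (suc D) * X))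
      ≈⟨ +-congˡ (solve 5 (λ I C l h X → I :* (C :* (l :* h :* X)) := (l :* I) :* (C :* (h :* X))) refl _ _ _ _ _) ⟩
    C n * (g m * U m (suc D) + U m D) + L D * L⁻¹ D * (C n * (g (suc D) * X))
      ≈⟨ +-congˡ (trans (*-congʳ (L-inverse D)) (trans (*-identityˡ _) (*-congˡ (g*L⁻¹ₛ D m)))) ⟩
    C n * (g m * U m (suc D) + U m D) + C n * (g m * X + Φ m (L⁻¹ₛ D m))
      ≈⟨ solve 6 (λ C g V W X Y → C :* (g :* V :+ W) :+ C :* (g :* X :+ Y) := C :* (g :* (V :+ X) :+ (W :+ Y))) refl _ _ _ _ _ _ ⟩
    C n * (g m * U m (2 ℕ.+ D) + U m (suc D)) ∎
    where
    m = 2 ℕ.+ n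
    X = Φ m (L⁻¹ₛ (suc D) m)

  L⁻¹ₛ-< : ∀ {d m} → d < m → L⁻¹ₛ d m ≡ 0#
  L⁻¹ₛ-< {zero} (s≤s _) = ≡.refl
  L⁻¹ₛ-< {suc d} (s≤s d<m) = L⁻¹ₛ-< d<m

  L⁻¹ₛ-+ : ∀ d m → L⁻¹ₛ (d ℕ.+ m) m ≡ L⁻¹ d
  L⁻¹ₛ-+ d zero = cong L⁻¹ (ℕₚ.+-identityʳ d)
  L⁻¹ₛ-+ d (suc m) rewrite ℕₚ.+-suc d m = L⁻¹ₛ-+ d m

  U-≤ : ∀ m D → D ≤ m → U m D ≈ 0#
  U-≤ m zero _ = refl
  U-≤ m (suc D) D<m = trans (+-cong (U-≤ m D (ℕₚ.<⇒≤ D<m)) (trans (Φ-cong m (reflexive (L⁻¹ₛ-< D<m))) (Φ-0 m))) (+-identityˡ _)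

  S-q^m : ∀ m d → S d (q ℕ.^ m) ≈ Φ m (L⁻¹ d)
  S-q^m m d = trans (reflexive (cong (S d) (≡.sym (ℕₚ.*-identityˡ (q ℕ.^ m))))) (trans (S-Φ m d 1) (Φ-cong m (S-1 d)))

  U-+ : ∀ m D → U m (D ℕ.+ m) ≈ Z [ q ℕ.^ m ] D
  U-+ m zero = U-≤ m m ℕₚ.≤-refl
  U-+ m (suc D) = +-cong (U-+ m D)
    (trans (Φ-cong m (reflexive (L⁻¹ₛ-+ D m))) (trans (sym (S-q^m m D)) (sym (*-identityʳ _))))

  ratio : ℕ → Carrier
  ratio n = (- 1#) ^ suc n * (((Φ (2 ℕ.+ n) θ + - θ) + - 1#) * ([ 0 ]⁻¹ * ([ suc n ]⁻¹ * ∏< n (λ j → Φ (suc n ∸ j) [ j ]⁻¹))))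

  Φ-[-1] : ∀ k n → Φ k ((- 1#) ^ n) ≈ (- 1#) ^ n
  Φ-[-1] k n = trans (Φ-^ k _ n) (^-congˡ n (trans (Φ-neg k 1#) (-‿cong (1^ (q ℕ.^ k)))))

  ∏<-Φ : ∀ n m → n ≤ m → Φ 1 (∏< n (λ j → Φ (m ∸ j) [ j ]⁻¹)) ≈ ∏< n (λ j → Φ (suc m ∸ j) [ j ]⁻¹)
  ∏<-Φ zero m _ = 1^ (q ℕ.^ 1)
  ∏<-Φ (suc n) m n<m = trans (Φ-* 1 _ _) (*-cong (∏<-Φ n m (ℕₚ.<⇒≤ n<m))
    (trans (Φ-1 _) (trans (sym (Φ-suc (m ∸ n) _)) (reflexive (cong (λ k → Φ k [ n ]⁻¹) (≡.sym (ℕₚ.+-∸-assoc 1 (ℕₚ.<⇒≤ n<m))))))))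

  -- The k-th bracket occurs in `κ n` with exponent `-q^(n-k)`, so `Φ 2` makes it `-q^(n+2-k)`; with
  -- `j = k - 1` this is the Frobenius index `suc n ∸ j`. The sign counts the n factors `g k = -[k]`
  -- and is fixed by the q-power map.
  Φ²-κ : ∀ n → Φ 2 (κ n) ≈ (- 1#) ^ n * ∏< n (λ j → Φ (suc n ∸ j) [ j ]⁻¹)
  Φ²-κ zero = trans (1^ (q ℕ.^ 2)) (sym (*-identityˡ 1#))
  Φ²-κ (suc n) = begin
    Φ 2 (Φ 1 (κ n) * g⁻¹ n)
      ≈⟨ trans (Φ-* 2 _ _) (*-cong (trans (Φ-∘ 2 1 _) (sym (Φ-∘ 1 2 _))) (Φ-neg 2 _)) ⟩
    Φ 1 (Φ 2 (κ n)) * - Φ 2 [ n ]⁻¹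
      ≈⟨ *-congʳ (trans (Φ-cong 1 (Φ²-κ n)) (trans (Φ-* 1 _ _) (*-cong (Φ-[-1] 1 n) (∏<-Φ n (suc n) (ℕₚ.n≤1+n n))))) ⟩
    (- 1#) ^ n * P * - Φ 2 [ n ]⁻¹
      ≈⟨ solve 3 (λ s P x → s :* P :* :- x := (:- (s :^ 0) :* s) :* (P :* x)) refl _ _ _ ⟩
    (- 1#) ^ suc n * (P * Φ 2 [ n ]⁻¹)
      ≈⟨ *-congˡ (*-congˡ (reflexive (cong (λ k → Φ k [ n ]⁻¹) (≡.sym (ℕₚ.m+n∸n≡m 2 n))))) ⟩
    (- 1#) ^ suc n * ∏< (suc n) (λ j → Φ (2 ℕ.+ n ∸ j) [ j ]⁻¹) ∎
    where P = ∏< n (λ j → Φ (2 ℕ.+ n ∸ j) [ j ]⁻¹)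

  -- The signs of `g⁻¹ 0` and `g⁻¹ (suc n)` cancel, and `g (2 + n) + 1 = -([n+2] - 1)` supplies the
  -- last sign.
  C*[g+1] : ∀ n → C n * (g (2 ℕ.+ n) + 1#) ≈ ratio n
  C*[g+1] n = trans (*-congʳ (*-congʳ (Φ²-κ n)))
    (solve 6 (λ s P i j t u → (s :* P) :* (:- i :* :- j) :* ((t :- u) :+ s :^ 0) := (:- (s :^ 0) :* s) :* (((u :- t) :- s :^ 0) :* (i :* (j :* P))))
      refl _ _ _ _ _ _)

  -- The truncation on the left is longer by `2 + n` to undo the index shift in `U`. The common part
  -- of the two sums then carries the factor `g (2 + n) + 1`, and the extra last term of the longer
  -- one gives the remainder.
  Z-tuple-ratio : ∀ n D → Z (1 ∷ inner n) (D ℕ.+ (2 ℕ.+ n)) ≈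
                  ratio n * Z [ q ℕ.^ (2 ℕ.+ n) ] D + C n * g (2 ℕ.+ n) * S D (q ℕ.^ (2 ℕ.+ n))
  Z-tuple-ratio n D = begin
    Z (1 ∷ inner n) (D ℕ.+ m)                       ≈⟨ Z-tuple n (D ℕ.+ m) ⟩
    C n * (g m * U m (suc D ℕ.+ m) + U m (D ℕ.+ m)) ≈⟨ *-congˡ (+-cong (*-congˡ (U-+ m (suc D))) (U-+ m D)) ⟩
    C n * (g m * (Z [ q ℕ.^ m ] D + S D (q ℕ.^ m) * 1#) + Z [ q ℕ.^ m ] D)
      ≈⟨ solve 4 (λ C g z s → C :* (g :* (z :+ s :* (s :^ 0)) :+ z) := (C :* (g :+ s :^ 0)) :* z :+ C :* g :* s) refl _ _ _ _ ⟩
    C n * (g m + 1#) * Z [ q ℕ.^ m ] D + C n * g m * S D (q ℕ.^ m)   ≈⟨ +-congʳ (*-congʳ (C*[g+1] n)) ⟩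
    ratio n * Z [ q ℕ.^ m ] D + C n * g m * S D (q ℕ.^ m)            ∎
    where m = 2 ℕ.+ n

-- Power series over F under the Cauchy product.

module PowerSeries (𝔽 : FiniteField) where
  open FiniteField 𝔽
  open Thakur 𝔽 using (sumF)
  open FieldFacts 𝔽 using (F-ring)
  open CommutativeRing F-ring using (+-identityˡ; +-identityʳ; +-comm; *-comm; zeroˡ; zeroʳ; distribˡ)
  open RingKit F-ring using (module Solver)
  open Solver using (solve; _:+_; _:*_; _:=_)
  open ≡.≡-Reasoning

  sumF-cong : ∀ n {f g : ℕ → F} → (∀ j → j < n → f j ≡ g j) → sumF n f ≡ sumF n g
  sumF-cong zero eq = ≡.refl
  sumF-cong (suc n) eq = cong₂ _+_ (sumF-cong n (λ j j<n → eq j (ℕₚ.m<n⇒m<1+n j<n))) (eq n ℕₚ.≤-refl)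

  sumF-head : ∀ n f → sumF (suc n) f ≡ f 0 + sumF n (f ∘ suc)
  sumF-head zero f = +-comm _ _
  sumF-head (suc n) f = ≡.trans (cong (_+ f (suc n)) (sumF-head n f)) (solve 3 (λ a b c → a :+ b :+ c := a :+ (b :+ c)) ≡.refl _ _ _)

  sumF-+ : ∀ n f g → sumF n (λ j → f j + g j) ≡ sumF n f + sumF n g
  sumF-+ zero f g = ≡.sym (+-identityˡ 0#)
  sumF-+ (suc n) f g = ≡.trans (cong (_+ (f n + g n)) (sumF-+ n f g)) (solve 4 (λ a b c d → a :+ b :+ (c :+ d) := a :+ c :+ (b :+ d)) ≡.refl _ _ _ _)

  sumF-* : ∀ n c f → sumF n (λ j → c * f j) ≡ c * sumF n f
  sumF-* zero c f = ≡.sym (zeroʳ c)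
  sumF-* (suc n) c f = ≡.trans (cong (_+ (c * f n)) (sumF-* n c f)) (≡.sym (distribˡ c _ _))

  Series : Set
  Series = ℕ → F

  conv : Series → Series → Series
  conv f g k = sumF (suc k) (λ j → f j * g (k ∸ j))

  conv-0 : ∀ f g → conv f g 0 ≡ f 0 * g 0
  conv-0 f g = +-identityˡ _

  -- Peeling off the first coefficient turns the product laws into inductions on the coefficient
  -- index, without rearranging double sums.
  conv-head : ∀ f g k → conv f g (suc k) ≡ f 0 * g (suc k) + conv (f ∘ suc) g k
  conv-head f g k = sumF-head (suc k) _

  conv-last : ∀ f g k → conv f g (suc k) ≡ conv f (g ∘ suc) k + f (suc k) * g 0
  conv-last f g k = cong₂ _+_
    (sumF-cong (suc k) (λ { j (s≤s j≤k) → cong (λ i → f j * g i) (ℕₚ.+-∸-assoc 1 j≤k) }))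
    (cong (λ i → f (suc k) * g i) (ℕₚ.n∸n≡0 k))

  conv-cong : ∀ {f f′ g g′} → (∀ k → f k ≡ f′ k) → (∀ k → g k ≡ g′ k) → ∀ k → conv f g k ≡ conv f′ g′ k
  conv-cong f≗ g≗ k = sumF-cong (suc k) (λ j _ → cong₂ _*_ (f≗ j) (g≗ (k ∸ j)))

  conv-comm : ∀ f g k → conv f g k ≡ conv g f k
  conv-comm f g zero = cong (λ u → 0# + u) (*-comm _ _)
  conv-comm f g (suc k) = begin
    conv f g (suc k)                             ≡⟨ conv-head f g k ⟩
    f 0 * g (suc k) + conv (f ∘ suc) g k         ≡⟨ cong₂ _+_ (*-comm _ _) (conv-comm (f ∘ suc) g k) ⟩
    g (suc k) * f 0 + conv g (f ∘ suc) k         ≡⟨ +-comm _ _ ⟩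
    conv g (f ∘ suc) k + g (suc k) * f 0         ≡⟨ conv-last g f k ⟨
    conv g f (suc k)                             ∎

  conv-+ˡ : ∀ f f′ g k → conv (λ j → f j + f′ j) g k ≡ conv f g k + conv f′ g k
  conv-+ˡ f f′ g k = ≡.trans (sumF-cong (suc k) (λ j _ → solve 3 (λ a b c → (a :+ b) :* c := a :* c :+ b :* c) ≡.refl _ _ _)) (sumF-+ (suc k) _ _)

  conv-+ʳ : ∀ f g g′ k → conv f (λ j → g j + g′ j) k ≡ conv f g k + conv f g′ k
  conv-+ʳ f g g′ k = ≡.trans (sumF-cong (suc k) (λ j _ → distribˡ _ _ _)) (sumF-+ (suc k) _ _)

  conv-*ˡ : ∀ c f g k → conv (λ j → c * f j) g k ≡ c * conv f g k
  conv-*ˡ c f g k = ≡.trans (sumF-cong (suc k) (λ j _ → solve 3 (λ a b c → (a :* b) :* c := a :* (b :* c)) ≡.refl _ _ _)) (sumF-* (suc k) c _)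

  conv-assoc : ∀ f g h k → conv (conv f g) h k ≡ conv f (conv g h) k
  conv-assoc f g h zero = begin
    conv (conv f g) h 0    ≡⟨ conv-0 (conv f g) h ⟩
    conv f g 0 * h 0       ≡⟨ cong (_* h 0) (conv-0 f g) ⟩
    f 0 * g 0 * h 0        ≡⟨ solve 3 (λ a b c → a :* b :* c := a :* (b :* c)) ≡.refl _ _ _ ⟩
    f 0 * (g 0 * h 0)      ≡⟨ cong (f 0 *_) (conv-0 g h) ⟨
    f 0 * conv g h 0       ≡⟨ conv-0 f (conv g h) ⟨
    conv f (conv g h) 0    ∎
  conv-assoc f g h (suc k) = begin
    conv (conv f g) h (suc k)
      ≡⟨ conv-head _ h k ⟩
    conv f g 0 * h (suc k) + conv (conv f g ∘ suc) h k
      ≡⟨ cong₂ _+_ (cong (_* h (suc k)) (conv-0 f g)) (conv-cong {g = h} (conv-head f g) (λ _ → ≡.refl) k) ⟩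
    f 0 * g 0 * h (suc k) + conv (λ j → f 0 * g (suc j) + conv (f ∘ suc) g j) h k
      ≡⟨ cong (λ u → f 0 * g 0 * h (suc k) + u) (≡.trans (conv-+ˡ _ _ h k) (cong₂ _+_ (conv-*ˡ (f 0) (g ∘ suc) h k) (conv-assoc (f ∘ suc) g h k))) ⟩
    f 0 * g 0 * h (suc k) + (f 0 * conv (g ∘ suc) h k + conv (f ∘ suc) (conv g h) k)
      ≡⟨ solve 5 (λ a b c d e → a :* b :* c :+ (a :* d :+ e) := a :* (b :* c :+ d) :+ e) ≡.refl _ _ _ _ _ ⟩
    f 0 * (g 0 * h (suc k) + conv (g ∘ suc) h k) + conv (f ∘ suc) (conv g h) k
      ≡⟨ cong (λ u → f 0 * u + conv (f ∘ suc) (conv g h) k) (conv-head g h k) ⟨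
    f 0 * conv g h (suc k) + conv (f ∘ suc) (conv g h) k
      ≡⟨ conv-head f (conv g h) k ⟨
    conv f (conv g h) (suc k) ∎

  conv-zeroˡ : ∀ {f} → (∀ k → f k ≡ 0#) → ∀ g k → conv f g k ≡ 0#
  conv-zeroˡ {f} f≗0 g zero = ≡.trans (conv-0 f g) (≡.trans (cong (_* g 0) (f≗0 0)) (zeroˡ _))
  conv-zeroˡ {f} f≗0 g (suc k) = ≡.trans (conv-head f g k)
    (≡.trans (cong₂ _+_ (≡.trans (cong (_* g (suc k)) (f≗0 0)) (zeroˡ _)) (conv-zeroˡ (f≗0 ∘ suc) g k)) (+-identityˡ _))

  conv-constˡ : ∀ {f} → (∀ k → f (suc k) ≡ 0#) → ∀ g k → conv f g k ≡ f 0 * g k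
  conv-constˡ {f} f≗0 g zero = conv-0 f g
  conv-constˡ {f} f≗0 g (suc k) = ≡.trans (conv-head f g k)
    (≡.trans (cong (λ u → f 0 * g (suc k) + u) (conv-zeroˡ f≗0 g k)) (+-identityʳ _))

-- The commutative ring of Laurent series.

module LaurentRing (𝔽 : FiniteField) where
  open import Data.Integer using (+_)
  open FiniteField 𝔽
  open Thakur 𝔽
  open FieldFacts 𝔽 using (F-ring)
  open PowerSeries 𝔽
  open CommutativeRing F-ring
    using (+-identityˡ; +-assoc; +-comm; -‿inverseˡ; -‿inverseʳ; *-identityˡ; *-identityʳ; zeroˡ; zeroʳ)
  open ℤSolver.+-*-Solver using (solve; _:+_; _:-_; _:=_; con)

  below-or-above : ∀ t i → t ℤ.< i ⊎ ∃ λ k → i ≡ t ℤ.- + k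
  below-or-above t i with i ℤ.≤? t
  ... | no i≰t = inj₁ (ℤₚ.≰⇒> i≰t)
  ... | yes i≤t = inj₂ (ℤ.∣ t ℤ.- i ∣ , ≡.trans
    (solve 2 (λ t i → i := t :- (t :- i)) ≡.refl t i)
    (cong (λ u → t ℤ.- u) (≡.sym (ℤₚ.0≤i⇒+∣i∣≡i (ℤₚ.i≤j⇒0≤j-i i≤t)))))

  coeff-above : ∀ L {i} → top L ℤ.< i → coeff L i ≡ 0#
  coeff-above L {i} t<i with i ℤ.≤? top L
  ... | yes i≤t = contradiction i≤t (ℤₚ.<⇒≱ t<i)
  ... | no _ = ≡.refl

  coeff-at : ∀ L k → coeff L (top L ℤ.- + k) ≡ co L k
  coeff-at L k with (top L ℤ.- + k) ℤ.≤? top L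
  ... | yes _ = cong (λ i → co L ℤ.∣ i ∣) (solve 2 (λ t k → t :- (t :- k) := k) ≡.refl (top L) (+ k))
  ... | no ≰ = contradiction (ℤₚ.i-j≤i (top L) (+ k)) ≰

  -- A record, so that the two series can be inferred from the type.
  infix 4 _≅_
  record _≅_ (L M : Laurent) : Set where
    constructor ≋⇒≅
    field ≅⇒≋ : L ≋ M
  open _≅_ public

  ≅-refl : ∀ {L} → L ≅ L
  ≅-refl = ≋⇒≅ λ _ → ≡.refl

  ≅-sym : ∀ {L M} → L ≅ M → M ≅ L
  ≅-sym (≋⇒≅ p) = ≋⇒≅ λ i → ≡.sym (p i)

  ≅-trans : ∀ {L M N} → L ≅ M → M ≅ N → L ≅ N
  ≅-trans (≋⇒≅ p) (≋⇒≅ p′) = ≋⇒≅ λ i → ≡.trans (p i) (p′ i)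

  ≅-by-cases : ∀ {L M} t → (∀ i → t ℤ.< i → coeff L i ≡ coeff M i) → (∀ k → coeff L (t ℤ.- + k) ≡ coeff M (t ℤ.- + k)) → L ≅ M
  ≅-by-cases {L} {M} t above below = ≋⇒≅ λ i → helper i (below-or-above t i)
    where
    helper : ∀ i → t ℤ.< i ⊎ (∃ λ k → i ≡ t ℤ.- + k) → coeff L i ≡ coeff M i
    helper i (inj₁ t<i) = above i t<i
    helper i (inj₂ (k , ≡.refl)) = below k

  laurent-cong : ∀ {t t′ f f′} → t ≡ t′ → (∀ k → f k ≡ f′ k) → laurent t f ≅ laurent t′ f′
  laurent-cong {t} {_} {f} {f′} ≡.refl f≗ = ≅-by-cases t
    (λ i t<i → ≡.trans (coeff-above (laurent t f) t<i) (≡.sym (coeff-above (laurent t f′) t<i)))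
    (λ k → ≡.trans (coeff-at (laurent t f) k) (≡.trans (f≗ k) (≡.sym (coeff-at (laurent t f′) k))))

  laurent-injective : ∀ {t f f′} → laurent t f ≅ laurent t f′ → ∀ k → f k ≡ f′ k
  laurent-injective {t} {f} {f′} (≋⇒≅ p) k = ≡.trans (≡.sym (coeff-at (laurent t f) k)) (≡.trans (p (t ℤ.- + k)) (coeff-at (laurent t f′) k))

  infix 4 _deg≤_
  _deg≤_ : Laurent → ℤ → Set
  L deg≤ t = ∀ i → t ℤ.< i → coeff L i ≡ 0#

  deg≤-top : ∀ L {t} → top L ℤ.≤ t → L deg≤ t
  deg≤-top L top≤t i t<i = coeff-above L (ℤₚ.≤-<-trans top≤t t<i)

  pad : ∀ {t L} → L deg≤ t → L ≅ laurent t (λ k → coeff L (t ℤ.- + k))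
  pad {t} {L} L≤t = ≅-by-cases t
    (λ i t<i → ≡.trans (L≤t i t<i) (≡.sym (coeff-above (laurent t _) t<i)))
    (λ k → ≡.sym (coeff-at (laurent t _) k))

  -- A series has many presentations, since leading coefficients may be 0. This is the elementary
  -- change of presentation, lowering `top` by one.
  drop-zero : ∀ {t f} → f 0 ≡ 0# → laurent (+ 1 ℤ.+ t) f ≅ laurent t (f ∘ suc)
  drop-zero {t} {f} f0≡0 = ≅-by-cases (+ 1 ℤ.+ t)
    (λ i t<i → ≡.trans (coeff-above (laurent (+ 1 ℤ.+ t) f) t<i)
                       (≡.sym (coeff-above (laurent t (f ∘ suc)) (ℤₚ.≤-<-trans (ℤₚ.i≤j+i t (+ 1)) t<i))))
    (λ { zero → ≡.trans (coeff-at (laurent (+ 1 ℤ.+ t) f) 0) (≡.trans f0≡0 (≡.sym (coeff-above (laurent t (f ∘ suc)) top<)))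
       ; (suc k) → ≡.trans (coeff-at (laurent (+ 1 ℤ.+ t) f) (suc k)) (≡.sym (≡.trans (cong (coeff (laurent t (f ∘ suc))) (index k)) (coeff-at (laurent t (f ∘ suc)) k))) })
    where
    top< : t ℤ.< (+ 1 ℤ.+ t) ℤ.- + 0
    top< = ≡.subst (t ℤ.<_) (≡.sym (ℤₚ.+-identityʳ (+ 1 ℤ.+ t))) (ℤₚ.suc[i]≤j⇒i<j ℤₚ.≤-refl)
    index : ∀ k → (+ 1 ℤ.+ t) ℤ.- + suc k ≡ t ℤ.- + k
    index k = solve 2 (λ t k → (con (+ 1) :+ t) :- (con (+ 1) :+ k) := t :- k) ≡.refl t (+ k)

  addL-coeff : ∀ L M i → coeff (addL L M) i ≡ coeff L i + coeff M i
  addL-coeff L M i with below-or-above (top L ℤ.⊔ top M) i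
  ... | inj₁ t<i = ≡.trans (coeff-above (addL L M) t<i) (≡.sym (≡.trans
          (cong₂ _+_ (coeff-above L (ℤₚ.≤-<-trans (ℤₚ.i≤i⊔j _ _) t<i)) (coeff-above M (ℤₚ.≤-<-trans (ℤₚ.i≤j⊔i (top L) (top M)) t<i)))
          (+-identityˡ _)))
  ... | inj₂ (k , ≡.refl) = coeff-at (addL L M) k

  negL-coeff : ∀ L i → coeff (negL L) i ≡ - coeff L i
  negL-coeff L i with i ℤ.≤? top L
  ... | yes _ = ≡.refl
  ... | no _ = ≡.sym (≡.trans (≡.sym (+-identityˡ _)) (-‿inverseʳ 0#))

  zeroL-coeff : ∀ i → coeff zeroL i ≡ 0#
  zeroL-coeff i with i ℤ.≤? + 0
  ... | yes _ = ≡.refl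
  ... | no _ = ≡.refl

  laurent-+ : ∀ t f f′ → laurent t (λ k → f k + f′ k) ≅ addL (laurent t f) (laurent t f′)
  laurent-+ t f f′ = ≅-by-cases t
    (λ i t<i → ≡.trans (coeff-above (laurent t _) t<i) (≡.sym (≡.trans (addL-coeff (laurent t f) (laurent t f′) i)
      (≡.trans (cong₂ _+_ (coeff-above (laurent t f) t<i) (coeff-above (laurent t f′) t<i)) (+-identityˡ _)))))
    (λ k → ≡.trans (coeff-at (laurent t _) k) (≡.sym (≡.trans (addL-coeff (laurent t f) (laurent t f′) (t ℤ.- + k))
      (cong₂ _+_ (coeff-at (laurent t f) k) (coeff-at (laurent t f′) k)))))

  addL-cong : ∀ {L L′ M M′} → L ≅ L′ → M ≅ M′ → addL L M ≅ addL L′ M′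
  addL-cong {L} {L′} {M} {M′} (≋⇒≅ p) (≋⇒≅ p′) = ≋⇒≅ λ i →
    ≡.trans (addL-coeff L M i) (≡.trans (cong₂ _+_ (p i) (p′ i)) (≡.sym (addL-coeff L′ M′ i)))

  mulL-comm : ∀ L M → mulL L M ≅ mulL M L
  mulL-comm L M = laurent-cong (ℤₚ.+-comm (top L) (top M)) (conv-comm (co L) (co M))

  mulL-drop-zero : ∀ {t f} M → f 0 ≡ 0# → mulL (laurent (+ 1 ℤ.+ t) f) M ≅ mulL (laurent t (f ∘ suc)) M
  mulL-drop-zero {t} {f} M f0≡0 = ≅-trans
    (laurent-cong (ℤₚ.+-assoc (+ 1) t (top M)) (λ _ → ≡.refl))
    (≅-trans (drop-zero (≡.trans (conv-0 f (co M)) (vanish (co M 0))))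
      (laurent-cong ≡.refl (λ k → ≡.trans (conv-head f (co M) k) (≡.trans (cong (_+ conv (f ∘ suc) (co M) k) (vanish _)) (+-identityˡ _)))))
    where
    vanish : ∀ x → f 0 * x ≡ 0#
    vanish x = ≡.trans (cong (_* x) f0≡0) (zeroˡ x)

  -- `mulL` acts on presentations, so it has to be shown to respect equality of series. The higher
  -- presentation has vanishing leading coefficients, which are removed one at a time by induction
  -- on the difference of the tops.
  mulL-cong-≤ : ∀ n {t f f′} M → laurent t f ≅ laurent (+ n ℤ.+ t) f′ → mulL (laurent t f) M ≅ mulL (laurent (+ n ℤ.+ t) f′) M
  mulL-cong-≤ zero {t} {f} {f′} M eq = laurent-cong (cong (ℤ._+ top M) (≡.sym (ℤₚ.+-identityˡ t)))
    (conv-cong {g = co M} (laurent-injective (≅-trans eq (laurent-cong (ℤₚ.+-identityˡ t) (λ _ → ≡.refl)))) (λ _ → ≡.refl))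
  mulL-cong-≤ (suc n) {t} {f} {f′} M eq = ≅-trans
    (mulL-cong-≤ n M (≅-trans eq′ (drop-zero f′0≡0)))
    (≅-trans (≅-sym (mulL-drop-zero {+ n ℤ.+ t} M f′0≡0)) (laurent-cong (cong (ℤ._+ top M) (≡.sym t′≡)) (λ _ → ≡.refl)))
    where
    t′≡ : + suc n ℤ.+ t ≡ + 1 ℤ.+ (+ n ℤ.+ t)
    t′≡ = ℤₚ.+-assoc (+ 1) (+ n) t
    eq′ : laurent t f ≅ laurent (+ 1 ℤ.+ (+ n ℤ.+ t)) f′
    eq′ = ≅-trans eq (laurent-cong t′≡ (λ _ → ≡.refl))
    -- The top coefficient of the higher presentation has an exponent above `t`, where the lower
    -- presentation has only zeros.
    f′0≡0 : f′ 0 ≡ 0#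
    f′0≡0 = ≡.trans (≡.sym (coeff-at (laurent (+ 1 ℤ.+ (+ n ℤ.+ t)) f′) 0))
      (≡.trans (≡.sym (≅⇒≋ eq′ ((+ 1 ℤ.+ (+ n ℤ.+ t)) ℤ.- + 0))) (coeff-above (laurent t f)
        (≡.subst (t ℤ.<_) (≡.sym (ℤₚ.+-identityʳ (+ 1 ℤ.+ (+ n ℤ.+ t))))
          (ℤₚ.suc[i]≤j⇒i<j (ℤₚ.+-monoʳ-≤ (+ 1) (ℤₚ.i≤j+i t (+ n)))))))

  mulL-congʳ : ∀ {L L′} M → L ≅ L′ → mulL L M ≅ mulL L′ M
  mulL-congʳ {laurent t f} {laurent t′ f′} M eq with below-or-above t t′
  ... | inj₂ (k , ≡.refl) = ≅-trans (laurent-cong (cong (ℤ._+ top M) (≡.sym t≡)) (λ _ → ≡.refl))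
          (≅-sym (mulL-cong-≤ k M (≅-trans (≅-sym eq) (laurent-cong (≡.sym t≡) (λ _ → ≡.refl)))))
    where
    t≡ : + k ℤ.+ (t ℤ.- + k) ≡ t
    t≡ = solve 2 (λ t k → k :+ (t :- k) := t) ≡.refl t (+ k)
  ... | inj₁ t<t′ with below-or-above t′ t
  ...   | inj₁ t′<t = contradiction (ℤₚ.<⇒≤ t<t′) (ℤₚ.<⇒≱ t′<t)
  ...   | inj₂ (k , ≡.refl) = ≅-trans (mulL-cong-≤ k M (≅-trans eq (laurent-cong (≡.sym t≡) (λ _ → ≡.refl))))
            (laurent-cong (cong (ℤ._+ top M) t≡) (λ _ → ≡.refl))
    where
    t≡ : + k ℤ.+ (t′ ℤ.- + k) ≡ t′
    t≡ = solve 2 (λ t k → k :+ (t :- k) := t) ≡.refl t′ (+ k)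

  mulL-congˡ : ∀ L {M M′} → M ≅ M′ → mulL L M ≅ mulL L M′
  mulL-congˡ L {M} {M′} eq = ≅-trans (mulL-comm L M) (≅-trans (mulL-congʳ L eq) (mulL-comm M′ L))

  mulL-distribˡ : ∀ L M N → mulL L (addL M N) ≅ addL (mulL L M) (mulL L N)
  mulL-distribˡ L M N = ≅-trans (laurent-cong ≡.refl (conv-+ʳ (co L) (padded M) (padded N)))
    (≅-trans (laurent-+ (top L ℤ.+ t) (conv (co L) (padded M)) (conv (co L) (padded N)))
      (addL-cong (≅-sym (mulL-congˡ L (pad (deg≤-top M (ℤₚ.i≤i⊔j _ _))))) (≅-sym (mulL-congˡ L (pad (deg≤-top N (ℤₚ.i≤j⊔i (top M) (top N))))))))
    where
    t = top M ℤ.⊔ top N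
    padded : Laurent → Series
    padded K k = coeff K (t ℤ.- + k)

  mulL-identityˡ : ∀ L → mulL oneL L ≅ L
  mulL-identityˡ L = laurent-cong (ℤₚ.+-identityˡ (top L))
    (λ k → ≡.trans (conv-constˡ (λ _ → ≡.refl) (co L) k) (*-identityˡ _))

  laurentRing : CommutativeRing 0ℓ 0ℓ
  laurentRing = record
    { Carrier = Laurent ; _≈_ = _≅_ ; _+_ = addL ; _*_ = mulL ; -_ = negL ; 0# = zeroL ; 1# = oneL
    ; isCommutativeRing = record
      { isRing = record
        { +-isAbelianGroup = record
          { isGroup = record
            { isMonoid = record
              { isSemigroup = record
                { isMagma = record
                  { isEquivalence = record { refl = ≅-refl ; sym = ≅-sym ; trans = ≅-trans }
                  ; ∙-cong = addL-cong
                  }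
                ; assoc = λ L M N → ≋⇒≅ λ i → begin
                    coeff (addL (addL L M) N) i             ≡⟨ addL-coeff (addL L M) N i ⟩
                    coeff (addL L M) i + coeff N i          ≡⟨ cong (_+ coeff N i) (addL-coeff L M i) ⟩
                    coeff L i + coeff M i + coeff N i       ≡⟨ +-assoc _ _ _ ⟩
                    coeff L i + (coeff M i + coeff N i)     ≡⟨ cong (λ u → coeff L i + u) (addL-coeff M N i) ⟨
                    coeff L i + coeff (addL M N) i          ≡⟨ addL-coeff L (addL M N) i ⟨
                    coeff (addL L (addL M N)) i             ∎
                }
              ; identity = addL-identityˡ , λ L → ≅-trans (addL-comm L zeroL) (addL-identityˡ L)
              }
            ; inverse = negL-inverseˡ , λ L → ≅-trans (addL-comm L (negL L)) (negL-inverseˡ L)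
            ; ⁻¹-cong = λ {L} {M} eq → ≋⇒≅ λ i →
                ≡.trans (negL-coeff L i) (≡.trans (cong -_ (≅⇒≋ eq i)) (≡.sym (negL-coeff M i)))
            }
          ; comm = addL-comm
          }
        ; *-cong = λ {L} {L′} {M} {M′} p p′ → ≅-trans (mulL-congʳ M p) (mulL-congˡ L′ p′)
        ; *-assoc = λ L M N → laurent-cong (ℤₚ.+-assoc (top L) (top M) (top N)) (conv-assoc (co L) (co M) (co N))
        ; *-identity = mulL-identityˡ , λ L → ≅-trans (mulL-comm L oneL) (mulL-identityˡ L)
        ; distrib = mulL-distribˡ , λ L M N → ≅-trans (mulL-comm (addL M N) L)
            (≅-trans (mulL-distribˡ L M N) (addL-cong (mulL-comm L M) (mulL-comm L N)))
        }
      ; *-comm = mulL-comm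
      }
    }
    where
    open ≡.≡-Reasoning
    addL-comm : ∀ L M → addL L M ≅ addL M L
    addL-comm L M = ≋⇒≅ λ i → ≡.trans (addL-coeff L M i) (≡.trans (+-comm _ _) (≡.sym (addL-coeff M L i)))
    addL-identityˡ : ∀ L → addL zeroL L ≅ L
    addL-identityˡ L = ≋⇒≅ λ i → ≡.trans (addL-coeff zeroL L i) (≡.trans (cong (_+ coeff L i) (zeroL-coeff i)) (+-identityˡ _))
    negL-inverseˡ : ∀ L → addL (negL L) L ≅ zeroL
    negL-inverseˡ L = ≋⇒≅ λ i → ≡.trans (addL-coeff (negL L) L i)
      (≡.trans (cong (_+ coeff L i) (negL-coeff L i)) (≡.trans (-‿inverseˡ _) (≡.sym (zeroL-coeff i))))

  laurentAlgebra : FieldAlgebra 𝔽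
  laurentAlgebra = record
    { ring = laurentRing
    ; ι = const
    ; ι-+ = λ a b → ≅-trans (laurent-cong ≡.refl λ { zero → ≡.refl ; (suc k) → ≡.sym (+-identityˡ 0#) }) (laurent-+ (+ 0) _ _)
    ; ι-* = λ a b → laurent-cong ≡.refl
        λ { zero → ≡.sym (conv-constˡ {co (const a)} (λ _ → ≡.refl) (co (const b)) 0)
          ; (suc k) → ≡.sym (≡.trans (conv-constˡ {co (const a)} (λ _ → ≡.refl) (co (const b)) (suc k)) (zeroʳ a)) }
    ; ι-0 = laurent-cong ≡.refl λ { zero → ≡.refl ; (suc k) → ≡.refl }
    ; ι-1 = ≅-refl
    }

  private module _ (L : Laurent) (monic : co L 0 ≡ 1#) where
    u : Series
    u = co (invMonic L)

    -- `invPrefix` stores the latest coefficient first, hence the reversed index; read this way, the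
    -- recursion for the inverse is a convolution.
    nth-invPrefix : ∀ k i → i ≤ k → nth (invPrefix L k) i ≡ u (k ∸ i)
    nth-invPrefix zero zero _ = ≡.refl
    nth-invPrefix (suc k) zero _ = ≡.refl
    nth-invPrefix (suc k) (suc i) (s≤s i≤k) = nth-invPrefix k i i≤k

    u-suc : ∀ k → u (suc k) ≡ - conv (co L ∘ suc) u k
    u-suc k = cong -_ (sumF-cong (suc k) (λ { j (s≤s j≤k) → cong (co L (suc j) *_) (nth-invPrefix k j j≤k) }))

  invMonic-inverse : ∀ L → co L 0 ≡ 1# → mulL L (invMonic L) ≅ oneL
  invMonic-inverse L monic = laurent-cong (ℤₚ.+-inverseʳ (top L))
    λ { zero → ≡.trans (conv-0 (co L) (u L monic)) (≡.trans (*-identityʳ _) monic)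
      ; (suc k) → ≡.trans (conv-head (co L) (u L monic) k)
          (≡.trans (cong (_+ conv (co L ∘ suc) (u L monic) k) (≡.trans (cong₂ _*_ monic (u-suc L monic k)) (*-identityˡ _))) (-‿inverseˡ _)) }

-- Degree bounds and convergence of the truncated sums.

module Degrees (𝔽 : FiniteField) where
  open import Data.Integer using (+_)
  open FiniteField 𝔽
  open Thakur 𝔽
  open FieldFacts 𝔽 using (F-ring)
  open LaurentRing 𝔽
  open CommutativeRing F-ring using (+-identityˡ; +-identityʳ; -‿inverseʳ)
  private module L = CommutativeRing laurentRing
  open RingKit laurentRing using (module Solver)

  deg≤-mono : ∀ {L s t} → s ℤ.≤ t → L deg≤ s → L deg≤ t
  deg≤-mono s≤t L≤s i t<i = L≤s i (ℤₚ.≤-<-trans s≤t t<i)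

  deg≤-add : ∀ {L M t} → L deg≤ t → M deg≤ t → addL L M deg≤ t
  deg≤-add {L} {M} L≤t M≤t i t<i = ≡.trans (addL-coeff L M i) (≡.trans (cong₂ _+_ (L≤t i t<i) (M≤t i t<i)) (+-identityˡ _))

  deg≤-mul : ∀ {L M s t} → L deg≤ s → M deg≤ t → mulL L M deg≤ s ℤ.+ t
  deg≤-mul {L} {M} {s} {t} L≤s M≤t i s+t<i = ≡.trans
    (≅⇒≋ (L.*-cong (pad L≤s) (pad M≤t)) i)
    (coeff-above (mulL (laurent s (λ k → coeff L (s ℤ.- + k))) (laurent t (λ k → coeff M (t ℤ.- + k)))) s+t<i)

  deg≤-zero : ∀ {t} → zeroL deg≤ t
  deg≤-zero i _ = zeroL-coeff i

  -d≤0 : ∀ d → ℤ.- (+ d) ℤ.≤ + 0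
  -d≤0 d = ℤₚ.neg-≤-pos {d} {0}

  deg≤-pow : ∀ {L} → L deg≤ + 0 → ∀ s → powL L s deg≤ + 0
  deg≤-pow L≤0 zero = deg≤-top oneL ℤₚ.≤-refl
  deg≤-pow L≤0 (suc s) = deg≤-mul L≤0 (deg≤-pow L≤0 s)

  -- One factor `1/a` already has degree `-d`, and the remaining ones have degree at most 0. The
  -- bound is uniform in `s` and strong enough for convergence.
  deg≤-S : ∀ d {s} → 1 ≤ s → S d s deg≤ ℤ.- (+ d)
  deg≤-S d {suc s} _ = go (allVecs d)
    where
    go : ∀ vs → sumL (List.map (λ v → powL (invMonic (monicPoly d v)) (suc s)) vs) deg≤ ℤ.- (+ d)
    go [] = deg≤-zero
    go (v ∷ vs) = deg≤-add (≡.subst (powL (invMonic (monicPoly d v)) (suc s) deg≤_) (ℤₚ.+-identityʳ _)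
      (deg≤-mul r≤ (deg≤-pow (deg≤-mono (-d≤0 d) r≤) s))) (go vs)
      where
      r≤ : invMonic (monicPoly d v) deg≤ ℤ.- (+ d)
      r≤ = deg≤-top (invMonic (monicPoly d v)) ℤₚ.≤-refl

  deg≤-Z : ∀ {ss} → All (1 ≤_) ss → ∀ D → Z ss D deg≤ + 0
  deg≤-Z-term : ∀ {s ss} → All (1 ≤_) (s ∷ ss) → ∀ d → mulL (S d s) (Z ss d) deg≤ ℤ.- (+ d)
  deg≤-Z [] D = deg≤-top oneL ℤₚ.≤-refl
  deg≤-Z (1≤s ∷ 1≤ss) zero = deg≤-zero
  deg≤-Z (1≤s ∷ 1≤ss) (suc D) = deg≤-add (deg≤-Z (1≤s ∷ 1≤ss) D) (deg≤-mono (-d≤0 D) (deg≤-Z-term (1≤s ∷ 1≤ss) D))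
  deg≤-Z-term {s} {ss} (1≤s ∷ 1≤ss) d = ≡.subst (mulL (S d s) (Z ss d) deg≤_) (ℤₚ.+-identityʳ _) (deg≤-mul (deg≤-S d 1≤s) (deg≤-Z 1≤ss d))

  Z-stable : ∀ {s ss} → All (1 ≤_) (s ∷ ss) → ∀ k D i → ℤ.- (+ D) ℤ.< i → coeff (Z (s ∷ ss) (k ℕ.+ D)) i ≡ coeff (Z (s ∷ ss) D) i
  Z-stable 1≤ zero D i _ = ≡.refl
  Z-stable {s} {ss} 1≤ (suc k) D i -D<i = ≡.trans
    (addL-coeff (Z (s ∷ ss) (k ℕ.+ D)) (mulL (S (k ℕ.+ D) s) (Z ss (k ℕ.+ D))) i)
    (≡.trans (cong₂ _+_ (Z-stable 1≤ k D i -D<i)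
        (deg≤-Z-term 1≤ (k ℕ.+ D) i (ℤₚ.≤-<-trans (ℤₚ.neg-mono-≤ (ℤ.+≤+ (ℕₚ.m≤n+m D k))) -D<i)))
      (+-identityʳ _))

  -- The definition of `ζ` uses a different truncation for each coefficient. By `Z-stable` these can
  -- be replaced by a single `D`, as long as only exponents above `-D` are read.
  ζ-coeff : ∀ {s ss} → All (1 ≤_) (s ∷ ss) → ∀ D i → ℤ.- (+ D) ℤ.< i → coeff (ζ (s ∷ ss)) i ≡ coeff (Z (s ∷ ss) D) i
  ζ-coeff {s} {ss} 1≤ D i -D<i with below-or-above (+ 0) i
  ... | inj₁ 0<i = ≡.trans (coeff-above (ζ (s ∷ ss)) 0<i) (≡.sym (deg≤-Z 1≤ D i 0<i))
  ... | inj₂ (m , ≡.refl) = ≡.trans (coeff-at (ζ (s ∷ ss)) m)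
    (≡.trans (cong (coeff (Z (s ∷ ss) (suc m))) (≡.sym (ℤₚ.+-identityˡ (ℤ.- (+ m)))))
      (≡.sym (≡.trans (cong (λ D → coeff (Z (s ∷ ss) D) (+ 0 ℤ.- + m)) (≡.sym (ℕₚ.m∸n+n≡m m<D)))
        (Z-stable 1≤ (D ∸ suc m) (suc m) (+ 0 ℤ.- + m) (≡.subst (ℤ.- (+ suc m) ℤ.<_) (≡.sym (ℤₚ.+-identityˡ (ℤ.- (+ m)))) (ℤₚ.neg-mono-< (ℤ.+<+ ℕₚ.≤-refl)))))))
    where
    m<D : m < D
    m<D = ℤₚ.drop‿+<+ (ℤₚ.neg-cancel-< (≡.subst (ℤ.- (+ D) ℤ.<_) (ℤₚ.+-identityˡ _) -D<i))

  -- Continuity of multiplication: the difference of the two factors has degree at most `t`, and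
  -- multiplying by `L` raises this bound by at most `top L`.
  mulL-agree : ∀ L {M M′ t} → (∀ i → t ℤ.< i → coeff M i ≡ coeff M′ i) →
               ∀ i → top L ℤ.+ t ℤ.< i → coeff (mulL L M) i ≡ coeff (mulL L M′) i
  mulL-agree L {M} {M′} {t} agree i <i = begin
    coeff (mulL L M) i                                           ≡⟨ ≅⇒≋ (solve 3 (λ L M M′ → L :* M := L :* M′ :+ L :* (M :- M′)) L.refl L M M′) i ⟩
    coeff (addL (mulL L M′) (mulL L (addL M (negL M′)))) i       ≡⟨ addL-coeff (mulL L M′) _ i ⟩
    coeff (mulL L M′) i + coeff (mulL L (addL M (negL M′))) i    ≡⟨ cong (λ u → coeff (mulL L M′) i + u) (deg≤-mul {L} (deg≤-top L ℤₚ.≤-refl) difference i <i) ⟩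
    coeff (mulL L M′) i + 0#                                     ≡⟨ +-identityʳ _ ⟩
    coeff (mulL L M′) i                                          ∎
    where
    open ≡.≡-Reasoning
    open Solver using (solve; _:+_; _:*_; _:-_; _:=_)
    difference : addL M (negL M′) deg≤ t
    difference j t<j = ≡.trans (addL-coeff M (negL M′) j)
      (≡.trans (cong₂ _+_ (agree j t<j) (negL-coeff M′ j)) (-‿inverseʳ _))

  eventually-below : ∀ x i → ∃ λ D₀ → ∀ D → D₀ ≤ D → x ℤ.- + D ℤ.< i
  eventually-below x i with below-or-above x i
  ... | inj₁ x<i = 0 , λ D _ → ℤₚ.≤-<-trans (ℤₚ.i-j≤i x (+ D)) x<i
  ... | inj₂ (k , ≡.refl) = suc k , λ D k<D → ℤₚ.+-monoʳ-< x (ℤₚ.neg-mono-< (ℤ.+<+ k<D))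

-- The exponent tuple in recursive form.

module Tuples (𝔽 : FiniteField) where
  open FiniteField 𝔽 using (q)
  open Thakur 𝔽 using (tuple)
  open Exponents 𝔽
  open ≡.≡-Reasoning

  private
    power : ℕ → ℕ → ℕ
    power k j = (q ∸ 1) ℕ.* q ℕ.^ (k ℕ.+ j)

    -- The list-building function local to `tuple` cannot be named here; abstracting over suc x
    -- separates its two arguments, so that unification can recover it.
    mutual
      upto : ℕ → ℕ → List ℕ
      upto = _

      tuple-suc : ∀ x → tuple (suc x) ≡ 1 ∷ (q ℕ.^ 2 ∸ 1) ∷ List.map (power 2) (upto (suc x) x ++ [ x ])
      tuple-suc x with suc x
      ... | _ = ≡.refl

    map-upto : ∀ (f : ℕ → ℕ) a m → List.map f (upto a m) ≡ applyUpTo f m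
    map-upto f a zero = ≡.refl
    map-upto f a (suc m) = begin
      List.map f (upto a m ++ [ m ])    ≡⟨ Listₚ.map-++ f (upto a m) [ m ] ⟩
      List.map f (upto a m) ++ [ f m ]  ≡⟨ cong (_++ [ f m ]) (map-upto f a m) ⟩
      applyUpTo f m ++ [ f m ]          ≡⟨ Listₚ.applyUpTo-∷ʳ f m ⟩
      applyUpTo f (suc m)               ∎

    tuple≡ : ∀ n → tuple n ≡ 1 ∷ (q ℕ.^ 2 ∸ 1) ∷ applyUpTo (power 2) n
    tuple≡ zero = ≡.refl
    tuple≡ (suc n) = ≡.trans (tuple-suc n) (cong (λ ss → 1 ∷ (q ℕ.^ 2 ∸ 1) ∷ ss) (map-upto (power 2) (suc n) (suc n)))

    applyUpTo-cong : ∀ {f g : ℕ → ℕ} → (∀ j → f j ≡ g j) → ∀ n → applyUpTo f n ≡ applyUpTo g n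
    applyUpTo-cong eq zero = ≡.refl
    applyUpTo-cong eq (suc n) = cong₂ _∷_ (eq 0) (applyUpTo-cong (eq ∘ suc) n)

    map-*q^k : ∀ k (g : ℕ → ℕ) n → List.map (ℕ._* q ℕ.^ k) (applyUpTo (λ j → (q ∸ 1) ℕ.* q ℕ.^ g j) n)
                                  ≡ applyUpTo (λ j → (q ∸ 1) ℕ.* q ℕ.^ (k ℕ.+ g j)) n
    map-*q^k k g n = ≡.trans (Listₚ.map-applyUpTo _ (ℕ._* q ℕ.^ k) n) (applyUpTo-cong (λ j → begin
      (q ∸ 1) ℕ.* q ℕ.^ g j ℕ.* q ℕ.^ k      ≡⟨ ℕₚ.*-assoc (q ∸ 1) (q ℕ.^ g j) (q ℕ.^ k) ⟩
      (q ∸ 1) ℕ.* (q ℕ.^ g j ℕ.* q ℕ.^ k)    ≡⟨ cong ((q ∸ 1) ℕ.*_) (ℕₚ.^-distribˡ-+-* q (g j) k) ⟨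
      (q ∸ 1) ℕ.* q ℕ.^ (g j ℕ.+ k)          ≡⟨ cong (λ i → (q ∸ 1) ℕ.* q ℕ.^ i) (ℕₚ.+-comm (g j) k) ⟩
      (q ∸ 1) ℕ.* q ℕ.^ (k ℕ.+ g j)          ∎) n)

    digits≡ : ∀ n → digits n ≡ applyUpTo (power 0) n
    digits≡ zero = ≡.refl
    digits≡ (suc n) = cong₂ _∷_
      (≡.trans (cong (_∸ 1) (ℕₚ.*-identityʳ q)) (≡.sym (ℕₚ.*-identityʳ (q ∸ 1))))
      (≡.trans (cong (List.map (ℕ._* q ℕ.^ 1)) (digits≡ n)) (map-*q^k 1 (λ j → j) n))

  tuple≡1∷inner : ∀ n → tuple n ≡ 1 ∷ inner n
  tuple≡1∷inner n = ≡.trans (tuple≡ n) (cong (λ ss → 1 ∷ (q ℕ.^ 2 ∸ 1) ∷ ss)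
    (≡.sym (≡.trans (cong (List.map (ℕ._* q ℕ.^ 2)) (digits≡ n)) (map-*q^k 2 (λ j → j) n))))

  module _ (1<q : 1 < q) where
    private
      instance
        q≢0 : NonZero q
        q≢0 = ℕ.>-nonZero (ℕₚ.<⇒≤ 1<q)

    1≤q^k∸1 : ∀ k → 1 ≤ q ℕ.^ suc k ∸ 1
    1≤q^k∸1 k = ℕₚ.m<n⇒0<n∸m (ℕₚ.<-≤-trans 1<q (ℕₚ.m≤m*n q (q ℕ.^ k) ⦃ ℕₚ.m^n≢0 q k ⦄))

    positive-map : ∀ k {ss} → All (1 ≤_) ss → All (1 ≤_) (List.map (ℕ._* q ℕ.^ k) ss)
    positive-map k = Allₚ.map⁺ ∘ All.map (λ {s} 1≤s → ℕₚ.≤-trans 1≤s (ℕₚ.m≤m*n s (q ℕ.^ k) ⦃ ℕₚ.m^n≢0 q k ⦄))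

    digits-positive : ∀ n → All (1 ≤_) (digits n)
    digits-positive zero = []
    digits-positive (suc n) = 1≤q^k∸1 0 ∷ positive-map 1 (digits-positive n)

    tuple-positive : ∀ n → All (1 ≤_) (1 ∷ inner n)
    tuple-positive n = s≤s z≤n ∷ 1≤q^k∸1 1 ∷ positive-map 2 (digits-positive n)

-- The evaluation in Laurent series and the passage to the limit.

module Comparison (𝔽 : FiniteField) (1<q : 1 < FiniteField.q 𝔽) where
  open import Data.Integer using (+_)
  open FiniteField 𝔽
  open Thakur 𝔽
  open FieldFacts 𝔽 using (F-ring)
  open PowerSeries 𝔽 using (conv-constˡ)
  open LaurentRing 𝔽
  open Degrees 𝔽
  open Exponents 𝔽
  open Tuples 𝔽
  open CommutativeRing F-ring using (+-identityˡ; +-identityʳ; *-identityˡ)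
  open Frobenius laurentAlgebra using (Φ; _^_)
  open PolynomialSums laurentAlgebra using (eval)
  private module L = CommutativeRing laurentRing
  private module LS = ListSums laurentRing

  θ : Laurent
  θ = θ^ 1

  powL≡^ : ∀ L s → powL L s ≡ L ^ s
  powL≡^ L zero = ≡.refl
  powL≡^ L (suc s) = cong (mulL L) (powL≡^ L s)

  θ*-co : ∀ L → mulL θ L ≅ laurent (+ 1 ℤ.+ top L) (co L)
  θ*-co L = laurent-cong ≡.refl (λ k → ≡.trans (conv-constˡ {co θ} (λ _ → ≡.refl) (co L) k) (*-identityˡ _))

  θ^≅ : ∀ n → θ^ n ≅ θ ^ n
  θ^≅ zero = laurent-cong ≡.refl λ { zero → ≡.refl ; (suc _) → ≡.refl }
  θ^≅ (suc n) = ≅-trans (laurent-cong ≡.refl λ { zero → ≡.refl ; (suc _) → ≡.refl })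
    (≅-trans (≅-sym (θ*-co (θ^ n))) (mulL-congˡ θ (θ^≅ n)))

  br≅ : ∀ k → br k ≅ Φ k θ L.+ L.- θ
  br≅ k = L.+-congʳ (θ^≅ (q ℕ.^ k))

  1<q^ : ∀ k → 1 < q ℕ.^ suc k
  1<q^ k = ℕₚ.<-≤-trans 1<q (ℕₚ.m≤m*n q (q ℕ.^ k) ⦃ ℕₚ.m^n≢0 q k ⦃ ℕ.>-nonZero (ℕₚ.<⇒≤ 1<q) ⦄ ⦄)

  -- `invMonic` inverts a series only if the coefficient at its declared `top` is 1. Since
  -- `q^(k+1) > 1`, the subtracted `θ` does not reach that position.
  br-monic : ∀ k → co (br (suc k)) 0 ≡ 1#
  br-monic k = ≡.trans (cong (λ t → coeff (θ^ N) t + coeff (negL θ) t) t≡)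
    (≡.trans (cong₂ _+_ (≡.trans (cong (coeff (θ^ N)) (≡.sym (ℤₚ.+-identityʳ (+ N)))) (coeff-at (θ^ N) 0)) (coeff-above (negL θ) (ℤ.+<+ (1<q^ k))))
      (+-identityʳ 1#))
    where
    N = q ℕ.^ suc k
    t≡ : (+ N ℤ.⊔ + 1) ℤ.- + 0 ≡ + N
    t≡ = ≡.trans (ℤₚ.+-identityʳ _) (ℤₚ.i≥j⇒i⊔j≡i (ℤ.+≤+ (ℕₚ.<⇒≤ (1<q^ k))))

  [_]⁻¹ : ℕ → Laurent
  [ k ]⁻¹ = invMonic (br (suc k))

  []-inverse : ∀ k → (Φ (suc k) θ L.+ L.- θ) L.* [ k ]⁻¹ ≅ L.1#
  []-inverse k = ≅-trans (mulL-congʳ [ k ]⁻¹ (≅-sym (br≅ (suc k)))) (invMonic-inverse (br (suc k)) (br-monic k))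

  monic-≤ : ∀ {d} (v : Vec F d) {i} → suc i ≤ d → co (monicPoly d v) (suc i) ≡ vget v (d ∸ suc i)
  monic-≤ {d} v {i} i<d with suc i ℕ.≤? d
  ... | yes _ = ≡.refl
  ... | no ≰ = contradiction i<d ≰

  monic-> : ∀ {d} (v : Vec F d) {i} → d < suc i → co (monicPoly d v) (suc i) ≡ 0#
  monic-> {d} v {i} d<1+i with suc i ℕ.≤? d
  ... | yes ≤d = contradiction ≤d (ℕₚ.<⇒≱ d<1+i)
  ... | no _ = ≡.refl

  -- `co` lists coefficients from the top down, so the new constant term stands at index `suc d`,
  -- just past the end of the shorter polynomial; hence the three cases for `j` against `d`.
  monic-co : ∀ {d} a (v : Vec F d) k →
    co (monicPoly (suc d) (a ∷ v)) k ≡ coeff (const a) (+ suc d ℤ.- + k) + co (monicPoly d v) k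
  monic-co a v zero = ≡.sym (+-identityˡ 1#)
  monic-co {d} a v (suc j) with ℕₚ.<-cmp j d
  ... | tri< j<d _ _ = begin
    co (monicPoly (suc d) (a ∷ v)) (suc j)                    ≡⟨ monic-≤ (a ∷ v) (ℕₚ.m<n⇒m<1+n j<d) ⟩
    vget (a ∷ v) (d ∸ j)                                      ≡⟨ cong (vget (a ∷ v)) d∸j≡ ⟩
    vget v (d ∸ suc j)                                        ≡⟨ +-identityˡ _ ⟨
    0# + vget v (d ∸ suc j)                                   ≡⟨ cong₂ _+_ (cong (coeff (const a)) (≡.trans (ℤₚ.⊖-≥ (s≤s (ℕₚ.<⇒≤ j<d))) (cong +_ d∸j≡))) (monic-≤ v j<d) ⟨
    coeff (const a) (+ suc d ℤ.- + suc j) + co (monicPoly d v) (suc j) ∎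
    where
    open ≡.≡-Reasoning
    d∸j≡ : d ∸ j ≡ suc (d ∸ suc j)
    d∸j≡ = ℕₚ.+-∸-assoc 1 j<d
  ... | tri≈ _ ≡.refl _ = begin
    co (monicPoly (suc d) (a ∷ v)) (suc d)                    ≡⟨ monic-≤ (a ∷ v) ℕₚ.≤-refl ⟩
    vget (a ∷ v) (d ∸ d)                                      ≡⟨ cong (vget (a ∷ v)) (ℕₚ.n∸n≡0 d) ⟩
    a                                                         ≡⟨ +-identityʳ _ ⟨
    a + 0#                                                    ≡⟨ cong₂ _+_ (cong (coeff (const a)) (ℤₚ.n⊖n≡0 (suc d))) (monic-> v ℕₚ.≤-refl) ⟨
    coeff (const a) (+ suc d ℤ.- + suc d) + co (monicPoly d v) (suc d) ∎
    where open ≡.≡-Reasoning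
  ... | tri> _ _ d<j = begin
    co (monicPoly (suc d) (a ∷ v)) (suc j)                    ≡⟨ monic-> (a ∷ v) (s≤s d<j) ⟩
    0#                                                        ≡⟨ +-identityˡ _ ⟨
    0# + 0#                                                   ≡⟨ cong₂ _+_ (cong (coeff (const a)) (≡.trans (ℤₚ.⊖-< (s≤s d<j)) (cong (λ k → ℤ.- (+ k)) (ℕₚ.+-∸-assoc 1 d<j)))) (monic-> v (ℕₚ.m<n⇒m<1+n d<j)) ⟨
    coeff (const a) (+ suc d ℤ.- + suc j) + co (monicPoly d v) (suc j) ∎
    where open ≡.≡-Reasoning

  monic-∷ : ∀ {d} a (v : Vec F d) → monicPoly (suc d) (a ∷ v) ≅ addL (const a) (mulL θ (monicPoly d v))
  monic-∷ {d} a v = ≅-trans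
    (≅-by-cases (+ suc d)
      (λ i d<i → ≡.trans (coeff-above P d<i) (≡.sym (≡.trans (addL-coeff (const a) M i)
        (≡.trans (cong₂ _+_ (coeff-above (const a) (ℤₚ.≤-<-trans (ℤ.+≤+ z≤n) d<i)) (coeff-above M d<i)) (+-identityˡ _)))))
      (λ k → ≡.trans (coeff-at P k) (≡.trans (monic-co a v k)
        (≡.sym (≡.trans (addL-coeff (const a) M (+ suc d ℤ.- + k)) (cong (λ u → coeff (const a) (+ suc d ℤ.- + k) + u) (coeff-at M k)))))))
    (L.+-congˡ {const a} (≅-sym (θ*-co (monicPoly d v))))
    where
    P = monicPoly (suc d) (a ∷ v)
    M = laurent (+ suc d) (co (monicPoly d v))

  monic≅ : ∀ {d} (v : Vec F d) → monicPoly d v ≅ θ ^ d L.+ eval v θ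
  monic≅ [] = ≅-trans (laurent-cong ≡.refl λ { zero → ≡.refl ; (suc _) → ≡.refl }) (L.sym (L.+-identityʳ oneL))
  monic≅ {suc d} (a ∷ v) = begin
    monicPoly (suc d) (a ∷ v)                     ≈⟨ monic-∷ a v ⟩
    const a L.+ θ L.* monicPoly d v               ≈⟨ L.+-congˡ {const a} (L.*-congˡ {θ} (monic≅ v)) ⟩
    const a L.+ θ L.* (θ ^ d L.+ eval v θ)        ≈⟨ solve 4 (λ a t u e → a :+ t :* (u :+ e) := t :* u :+ (a :+ t :* e)) L.refl (const a) θ (θ ^ d) (eval v θ) ⟩
    θ ^ suc d L.+ eval (a ∷ v) θ                  ∎
    where
    open import Relation.Binary.Reasoning.Setoid L.setoid
    open RingKit laurentRing using (module Solver)
    open Solver using (solve; _:+_; _:*_; _:=_)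

  r : ∀ d → Vec F d → Laurent
  r d v = invMonic (monicPoly d v)

  r-inverse : ∀ d v → (θ ^ d L.+ eval v θ) L.* r d v ≅ L.1#
  r-inverse d v = ≅-trans (mulL-congʳ (r d v) (≅-sym (monic≅ v))) (invMonic-inverse (monicPoly d v) ≡.refl)

  invertibleMonics : InvertibleMonics laurentAlgebra
  invertibleMonics = record { θ = θ ; [_]⁻¹ = [_]⁻¹ ; []-inverse = []-inverse ; r = r ; r-inverse = r-inverse }

  private module M = Multizeta laurentAlgebra invertibleMonics

  S≅ : ∀ d s → S d s ≅ M.S d s
  S≅ d s = LS.∑-cong (allVecs d) (λ v → L.reflexive (powL≡^ (r d v) s))

  Z≅ : ∀ ss D → Z ss D ≅ M.Z ss D
  Z≅ [] D = ≅-refl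
  Z≅ (s ∷ ss) zero = ≅-refl
  Z≅ (s ∷ ss) (suc D) = L.+-cong (Z≅ (s ∷ ss) D) (L.*-cong (S≅ D s) (Z≅ ss D))

  ratio≅ : ∀ n → ratio n ≅ M.ratio n
  ratio≅ n = L.*-cong (L.reflexive (powL≡^ (negL oneL) (suc n)))
    (L.*-cong (L.+-congʳ {negL oneL} (br≅ (2 ℕ.+ n))) (L.*-congˡ {[ 0 ]⁻¹} (L.*-congˡ {[ suc n ]⁻¹} (product n))))
    where
    product : ∀ m → prodRange m (λ j → powL [ j ]⁻¹ (q ℕ.^ (suc n ∸ j))) ≅ M.∏< m (λ j → Φ (suc n ∸ j) [ j ]⁻¹)
    product zero = ≅-refl
    product (suc m) = L.*-cong (product m) (L.reflexive (powL≡^ [ m ]⁻¹ (q ℕ.^ (suc n ∸ m))))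

  remainder : ℕ → Laurent
  remainder n = M.C n L.* M.g (2 ℕ.+ n)

  Z-identity : ∀ n D → Z (1 ∷ inner n) (D ℕ.+ (2 ℕ.+ n)) ≅
    addL (mulL (ratio n) (Z [ q ℕ.^ (2 ℕ.+ n) ] D)) (mulL (remainder n) (S D (q ℕ.^ (2 ℕ.+ n))))
  Z-identity n D = ≅-trans (Z≅ (1 ∷ inner n) (D ℕ.+ (2 ℕ.+ n))) (≅-trans (M.Z-tuple-ratio n D)
    (≅-sym (L.+-cong (L.*-cong (ratio≅ n) (Z≅ [ q ℕ.^ (2 ℕ.+ n) ] D)) (L.*-congˡ {remainder n} (S≅ D (q ℕ.^ (2 ℕ.+ n)))))))

  -- Each coefficient is compared at one large truncation. `D₀` makes the truncation on the left
  -- exact at `i`, `D₁` allows for the shift by `top (ratio n)` when `ζ` replaces its truncation,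
  -- and `D₂` pushes the remainder below `i`.
  zeta-like : ∀ n → ζ (1 ∷ inner n) ≋ mulL (ratio n) (ζ [ q ℕ.^ (2 ℕ.+ n) ])
  zeta-like n i = begin
    coeff (ζ (1 ∷ inner n)) i
      ≡⟨ ζ-coeff (tuple-positive 1<q n) (D ℕ.+ m) i (≡.subst (ℤ._< i) (ℤₚ.+-identityˡ _) (small₀ (D ℕ.+ m) (ℕₚ.≤-trans (ℕₚ.≤-trans (ℕₚ.m≤m+n D₀ D₁) (ℕₚ.m≤m+n _ D₂)) (ℕₚ.m≤m+n D m)))) ⟩
    coeff (Z (1 ∷ inner n) (D ℕ.+ m)) i
      ≡⟨ ≅⇒≋ (Z-identity n D) i ⟩
    coeff (addL (mulL (ratio n) (Z [ Q ] D)) (mulL (remainder n) (S D Q))) i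
      ≡⟨ addL-coeff (mulL (ratio n) (Z [ Q ] D)) (mulL (remainder n) (S D Q)) i ⟩
    coeff (mulL (ratio n) (Z [ Q ] D)) i + coeff (mulL (remainder n) (S D Q)) i
      ≡⟨ cong₂ _+_
           (mulL-agree (ratio n) {Z [ Q ] D} {ζ [ Q ]} (λ j -D<j → ≡.sym (ζ-coeff (1≤Q ∷ []) D j -D<j)) i (small₁ D (ℕₚ.≤-trans (ℕₚ.m≤n+m D₁ D₀) (ℕₚ.m≤m+n _ D₂))))
           (deg≤-mul {remainder n} {S D Q} (deg≤-top (remainder n) ℤₚ.≤-refl) (deg≤-S D 1≤Q) i (small₂ D (ℕₚ.m≤n+m D₂ _))) ⟩
    coeff (mulL (ratio n) (ζ [ Q ])) i + 0#
      ≡⟨ +-identityʳ _ ⟩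
    coeff (mulL (ratio n) (ζ [ Q ])) i ∎
    where
    open ≡.≡-Reasoning
    m = 2 ℕ.+ n
    Q = q ℕ.^ m
    1≤Q : 1 ≤ Q
    1≤Q = ℕₚ.<⇒≤ (1<q^ (suc n))
    below₀ = eventually-below (+ 0) i
    below₁ = eventually-below (top (ratio n)) i
    below₂ = eventually-below (top (remainder n)) i
    D₀ = proj₁ below₀
    D₁ = proj₁ below₁
    D₂ = proj₁ below₂
    small₀ = proj₂ below₀
    small₁ = proj₂ below₁
    small₂ = proj₂ below₂
    D = D₀ ℕ.+ D₁ ℕ.+ D₂

open import Data.Nat using (_^_; _+_)

theorem4p5 : (𝔽 : FiniteField) → 2 < FiniteField.q 𝔽 → (n : ℕ) →
    let open Thakur 𝔽 in
    ζ (tuple n) ≋ mulL (ratio n) (ζ [ FiniteField.q 𝔽 ^ (n + 2) ])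
theorem4p5 𝔽 2<q n = ≡.subst₂ (λ ss m → ζ ss ≋ mulL (ratio n) (ζ [ FiniteField.q 𝔽 ^ m ]))
  (≡.sym (Tuples.tuple≡1∷inner 𝔽 n)) (ℕₚ.+-comm 2 n) (Comparison.zeta-like 𝔽 (ℕₚ.<⇒≤ 2<q) n)
  where open Thakur 𝔽
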